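{- Let $n\geq1$, $r=2^n$ and $M=10^{2^n}+1$. Let $\pi=1-\zeta_5-\zeta_5^3\in\mathbb{Z}[\zeta_{10}]$ and $\alpha=(\pi/\bar\pi)^{1+3\sigma_{ -3}}$. For $k\geq0$ define $S_k^{(1)}=\alpha_1^{(k)}+\alpha_2^{(k)}$ and $S_k^{(2)}=\alpha_1^{(k)}\cdot\alpha_2^{(k)}$, where $\alpha_1^{(k)}=\alpha^{10^k}+\bar\alpha^{10^k}$ and $\alpha_2^{(k)}=\sigma_3(\alpha_1^{(k)})$. Suppose that every integer $x$ with $1<x<5^r$ and $x^4\equiv1\pmod{5^r}$ does not divide $M$. Then $M$ is prime if and only if $S_{r-1}^{(1)}\equiv1\pmod M$ and $S_{r-1}^{(2)}\equiv-1\pmod M$.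
   Context: $\zeta_m=e^{2\pi\sqrt{ -1}/m}$ and a bar denotes complex conjugation. For $c$ coprime to $10$, $\sigma_c\in G=\mathrm{Gal}(\mathbb{Q}(\zeta_{10})/\mathbb{Q})$ sends $\zeta_{10}$ to $\zeta_{10}^c$; $1$ denotes $\sigma_1$ in $\mathbb{Z}[G]$. For $\tau=\sum_{\sigma\in G}k_\sigma\sigma\in\mathbb{Z}[G]$ and $\beta\neq0$, $\beta^\tau:=\prod_{\sigma}\sigma(\beta)^{k_\sigma}$. The $S_k^{(j)}$ are rational numbers with denominators prime to $M$; congruences modulo $M$ are understood in the ring of rationals with denominator prime to $M$. -}

module Defs where

open import Level using (0ℓ)
open import Algebra.Bundles.Raw using (RawRing)
import Algebra.Definitions.RawSemiring as RawSemiringDefs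
open import Data.Bool.Base using (if_then_else_)
open import Data.Integer.Base as ℤ using (ℤ; +_; -[1+_]; +0; +[1+_])
open import Data.List.Base using (List; []; _∷_; map; foldr)
open import Data.Nat.Base as ℕ using (ℕ; suc; _≡ᵇ_)
open import Data.Nat.Coprimality using (Coprime)
open import Data.Product.Base using (_×_; ∃-syntax)
open import Data.Rational.Base as ℚ using (ℚ; mkℚ; 0ℚ; 1ℚ; 1/_; ↧ₙ_)
open import Relation.Binary.PropositionalEquality using (_≡_; refl)

-- ℚ(ζ₁₀) = ℚ[X]/(Φ₁₀) with Φ₁₀ = X⁴ - X³ + X² - X + 1;
-- ⟨ a , b , c , d ⟩ is a + b ζ₁₀ + c ζ₁₀² + d ζ₁₀³.
record K : Set where
  constructor ⟨_,_,_,_⟩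
  field
    coeff₀ coeff₁ coeff₂ coeff₃ : ℚ

open K public

ι : ℚ → K
ι q = ⟨ q , 0ℚ , 0ℚ , 0ℚ ⟩

0K 1K ζ₁₀ : K
0K  = ι 0ℚ
1K  = ι 1ℚ
ζ₁₀ = ⟨ 0ℚ , 1ℚ , 0ℚ , 0ℚ ⟩

infixl 6 _+_ _-_
infixl 7 _*_
infix  8 -_

_+_ : K → K → K
⟨ a₀ , a₁ , a₂ , a₃ ⟩ + ⟨ b₀ , b₁ , b₂ , b₃ ⟩ =
  ⟨ a₀ ℚ.+ b₀ , a₁ ℚ.+ b₁ , a₂ ℚ.+ b₂ , a₃ ℚ.+ b₃ ⟩

-_ : K → K
- ⟨ a₀ , a₁ , a₂ , a₃ ⟩ = ⟨ ℚ.- a₀ , ℚ.- a₁ , ℚ.- a₂ , ℚ.- a₃ ⟩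

_-_ : K → K → K
x - y = x + (- y)

-- The product of the polynomials is c₀ + … + c₆ ζ₁₀⁶, reduced with
-- ζ₁₀⁴ = ζ₁₀³ - ζ₁₀² + ζ₁₀ - 1,  ζ₁₀⁵ = -1,  ζ₁₀⁶ = - ζ₁₀.
_*_ : K → K → K
⟨ a₀ , a₁ , a₂ , a₃ ⟩ * ⟨ b₀ , b₁ , b₂ , b₃ ⟩ =
  ⟨ c₀ ℚ.- c₄ ℚ.- c₅ , c₁ ℚ.+ c₄ ℚ.- c₆ , c₂ ℚ.- c₄ , c₃ ℚ.+ c₄ ⟩
  where
  c₀ c₁ c₂ c₃ c₄ c₅ c₆ : ℚ
  c₀ = a₀ ℚ.* b₀
  c₁ = a₀ ℚ.* b₁ ℚ.+ a₁ ℚ.* b₀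
  c₂ = a₀ ℚ.* b₂ ℚ.+ a₁ ℚ.* b₁ ℚ.+ a₂ ℚ.* b₀
  c₃ = a₀ ℚ.* b₃ ℚ.+ a₁ ℚ.* b₂ ℚ.+ a₂ ℚ.* b₁ ℚ.+ a₃ ℚ.* b₀
  c₄ = a₁ ℚ.* b₃ ℚ.+ a₂ ℚ.* b₂ ℚ.+ a₃ ℚ.* b₁
  c₅ = a₂ ℚ.* b₃ ℚ.+ a₃ ℚ.* b₂
  c₆ = a₃ ℚ.* b₃

K-rawRing : RawRing 0ℓ 0ℓ
K-rawRing = record
  { Carrier = K ; _≈_ = _≡_ ; _+_ = _+_ ; _*_ = _*_ ; -_ = -_ ; 0# = 0K ; 1# = 1K }

open RawSemiringDefs (RawRing.rawSemiring K-rawRing) public using (_^_)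

-- Gal(ℚ(ζ₁₀)/ℚ) ≅ (ℤ/10)ˣ: σ_c depends only on c mod 10, so
-- σ₋₃ = σ₇ and σ₋₁ = σ₉.
data G : Set where
  σ₁ σ₃ σ₋₃ σ₋₁ : G

residue : G → ℕ
residue σ₁  = 1
residue σ₃  = 3
residue σ₋₃ = 7
residue σ₋₁ = 9

infixr 9 _⟦_⟧

_⟦_⟧ : G → K → K
σ ⟦ ⟨ a₀ , a₁ , a₂ , a₃ ⟩ ⟧ =
  ι a₀ + ι a₁ * z + ι a₂ * z ^ 2 + ι a₃ * z ^ 3
  where
  z : K
  z = ζ₁₀ ^ residue σ

-- Complex conjugation sends ζ₁₀ to ζ₁₀⁻¹.
conj : K → K
conj x = σ₋₁ ⟦ x ⟧

-- Convention: 0⁻¹ = 0.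
ℚ-inv : ℚ → ℚ
ℚ-inv (mkℚ +0 _ _)           = 0ℚ
ℚ-inv p@(mkℚ +[1+ _ ] _ _)   = 1/ p
ℚ-inv p@(mkℚ -[1+ _ ] _ _)   = 1/ p

cofactor : K → K
cofactor x = σ₃ ⟦ x ⟧ * σ₋₃ ⟦ x ⟧ * σ₋₁ ⟦ x ⟧

-- N(x) = ∏_σ σ(x) is fixed by G, hence equal to its constant coefficient.
norm : K → ℚ
norm x = coeff₀ (x * cofactor x)

-- x⁻¹ = σ₃(x) σ₋₃(x) σ₋₁(x) / N(x) for x ≠ 0, and 0⁻¹ = 0.
infix 9 _⁻¹

_⁻¹ : K → K
x ⁻¹ = cofactor x * ι (ℚ-inv (norm x))

infixl 7 _/_

_/_ : K → K → K
x / y = x * y ⁻¹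

infixr 8 _^ℤ_

_^ℤ_ : K → ℤ → K
x ^ℤ (+ n)    = x ^ n
x ^ℤ -[1+ n ] = (x ⁻¹) ^ suc n

-- τ = ∑_σ k_σ σ is represented by the function σ ↦ k_σ.
ℤ[G] : Set
ℤ[G] = G → ℤ

[_] : G → ℤ[G]
[ σ ] σ′ = if residue σ ≡ᵇ residue σ′ then ℤ.1ℤ else ℤ.0ℤ

infixl 6 _⊕_
infixr 7 _•_

_⊕_ : ℤ[G] → ℤ[G] → ℤ[G]
(τ ⊕ τ′) σ = τ σ ℤ.+ τ′ σ

_•_ : ℤ → ℤ[G] → ℤ[G]
(k • τ) σ = k ℤ.* τ σ

infixr 8 _^ᴳ_

_^ᴳ_ : K → ℤ[G] → K
β ^ᴳ τ = foldr _*_ 1K (map (λ σ → (σ ⟦ β ⟧) ^ℤ τ σ) (σ₁ ∷ σ₃ ∷ σ₋₃ ∷ σ₋₁ ∷ []))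

ζ₅ : K
ζ₅ = ζ₁₀ ^ 2

π : K
π = 1K - ζ₅ - ζ₅ ^ 3

-- As N(π̄) ≠ 0, the convention 0⁻¹ = 0 plays no role in α.
norm-conj-π : norm (conj π) ≡ + 11 ℚ./ 1
norm-conj-π = refl

α : K
α = (π / conj π) ^ᴳ ([ σ₁ ] ⊕ (+ 3) • [ σ₋₃ ])

α₁ α₂ : ℕ → K
α₁ k = α ^ (10 ℕ.^ k) + conj α ^ (10 ℕ.^ k)
α₂ k = σ₃ ⟦ α₁ k ⟧

S⁽¹⁾ S⁽²⁾ : ℕ → K
S⁽¹⁾ k = α₁ k + α₂ k
S⁽²⁾ k = α₁ k * α₂ k

-- Membership in the ring of rationals with denominator prime to M;
-- ↧ₙ is the denominator in lowest terms.
Integral : ℕ → ℚ → Set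
Integral M q = Coprime (↧ₙ q) M

infix 4 _≡_⟨mod_⟩

-- Congruence in that ring, for elements of ℚ(ζ₁₀) that lie in it.
_≡_⟨mod_⟩ : K → K → ℕ → Set
x ≡ y ⟨mod M ⟩ =
  ∃[ s ] ∃[ t ] (x ≡ ι s × Integral M s) × (y ≡ ι t × Integral M t) ×
    (∃[ q ] Integral M q × s ℚ.- t ≡ (+ M ℚ./ 1) ℚ.* q)

{-# OPTIONS --safe #-}

-- Let e = (M - 1)/10 = 10ʳ⁻¹ and let g be the Gauss sum of the character χ of 𝔽₁₁ˣ of order 10 with χ(2) = ζ³.
-- By Stickelberger's factorisation g¹⁰ = ζ³ α (σ₃(π) σ₋₁(π))¹⁰.
-- If M is prime, then M ≡ 1 mod 10 and M ≡ 2 mod 11 give gᴹ ≡ χ(2)⁻¹ g mod M. Hence (g¹⁰)ᵉ ≡ χ(2)⁻¹; as 10 divides e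
-- and (xᵉ)¹⁰ ≡ 1 for every unit x, this says that αᵉ ≡ χ(2)⁻¹ is a primitive tenth root of unity, whence the congruences.
-- Conversely, the congruences make y = αᵉ a root of Φ₁₀ modulo every prime p ∣ M. As x^p⁴ = x in ℤ[ζ]/p, it follows that
-- 5ʳ divides p⁴ - 1, so that p ≥ 5ʳ by hypothesis, and M < 25ʳ is prime.
-- No 11th root of unity is adjoined: g lives in the group semiring of ℤ/11 over ℤ[ζ]/M, where g¹¹ = w g with w ∈ ℤ[ζ].
module Submission where

open import Level using (Level; 0ℓ; _⊔_)
open import Algebra.Bundles using (CommutativeRing; CommutativeSemiring)
open import Algebra.Structures using (IsCommutativeRing)
open import Algebra.Structures.Biased using (IsCommutativeSemiringˡ; IsCommutativeMonoidˡ)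
import Algebra.Properties.Semiring.Exp as Exp
open import Data.Fin.Base as Fin using (Fin; toℕ; inject₁; fromℕ)
open import Data.Fin.Patterns
open import Data.Fin.Permutation using (Permutation′; permutation)
import Data.Fin.Properties as Fin
open import Data.Integer.Base as ℤ using (ℤ; +_; -[1+_]; 0ℤ; 1ℤ; -1ℤ)
import Data.Integer.Divisibility.Signed as Signed
import Data.Integer.Properties as ℤ
import Data.Integer.Solver as ℤ-Solver
open import Data.List.Base using ([]; _∷_)
open import Data.List.Relation.Unary.All using ([]; _∷_)
open import Data.Nat.Base as ℕ using (ℕ; zero; suc; s≤s; z≤n)
open import Data.Nat.Coprimality as Coprimality using (Coprime; 1-coprimeTo; coprime-divisor)
import Data.Nat.Divisibility as ℕ∣
open import Data.Nat.GCD using (gcd; gcd-GCD; module Bézout; gcd[m,n]∣m; gcd[m,n]∣n)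
open import Data.Nat.ListAction using (product)
open import Data.Nat.Primality
  using (Prime; prime?; prime⇒nonZero; prime⇒nonTrivial; ¬prime[1]; euclidsLemma; _Rough_; rough∧square>⇒prime)
open import Data.Nat.Primality.Factorisation using (factorise)
import Data.Nat.Properties as ℕ
import Data.Nat.Solver as ℕ-Solver
open import Data.Product.Base using (_×_; _,_; proj₁; proj₂; ∃-syntax)
open import Data.Rational.Base as ℚ using (ℚ; mkℚ; 0ℚ; 1ℚ; ↥_; ↧_; ↧ₙ_)
import Data.Rational.Properties as ℚ
import Data.Rational.Solver as ℚ-Solver
import Data.Rational.Unnormalised.Base as ℚᵘ
import Data.Rational.Unnormalised.Properties as ℚᵘ
open import Data.Sum.Base using (_⊎_; inj₁; inj₂)
open import Data.Vec.Base using (Vec; []; _∷_; lookup; tabulate)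
open import Data.Vec.Functional using (Vector)
open import Data.Vec.Properties using (lookup∘tabulate)
open import Function.Bundles using (_⇔_; mk⇔; Equivalence)
open import Relation.Binary.PropositionalEquality as ≡ using (_≡_; refl; cong; cong₂; subst)
open import Relation.Binary.Structures using (IsEquivalence)
open import Relation.Nullary.Decidable using (yes; no; from-yes; _⊎-dec_)
open import Relation.Nullary.Negation.Core using (¬_; contradiction)

-- Write H = σ₃(π) σ₋₁(π). Then α H¹⁰ = π σ₋₃(π)³ σ₃(π)⁷ σ₋₁(π)⁹ carries the Stickelberger exponents
-- 1, 3, 7, 9; α is what remains of g¹⁰ up to a root of unity and a tenth power. As N(π) = 11, the
-- number A = 11³ α = π⁴ π̄² σ₋₃(π)⁶ lies in ℤ[ζ]. Hence the constant 1331: all powers are taken of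
-- A, and denominators return only in the comparison with `S⁽¹⁾` and `S⁽²⁾`. The factorisation
-- itself is checked numerically, by multiplying out Jacobi sums. In the group semiring g¹⁰ is not a
-- scalar but a scalar multiple of 11 - ∑ₜ [t]. A further factor g kills ∑ₜ [t], so every exponent
-- there has the form 10e + 1. The ring ℤ[ζ]/p may have zero divisors. The order argument therefore
-- works with gcds of exponents and explicit inverses, and its contradiction is the equation 5 = 0.

private variable c ℓ : Level

-- The Frobenius map in characteristic p

module PrimeCharacteristic where
  open import Data.Nat.Combinatorics using (_C_; nC1≡n; nCn≡1; nCk+nC[k+1]≡[n+1]C[k+1]; k>n⇒nCk≡0)

  -- The absorption identity, by induction along Pascal's rule. Through Euclid's lemma it makes p
  -- divide the inner binomial coefficients.
  [k+1]*[n+1]C[k+1]≡[n+1]*nCk : ∀ n k → suc k ℕ.* (suc n C suc k) ≡ suc n ℕ.* (n C k)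
  [k+1]*[n+1]C[k+1]≡[n+1]*nCk zero zero = refl
  [k+1]*[n+1]C[k+1]≡[n+1]*nCk zero (suc k) = begin
    (2 ℕ.+ k) ℕ.* (1 C (2 ℕ.+ k)) ≡⟨ cong ((2 ℕ.+ k) ℕ.*_) (k>n⇒nCk≡0 {1} {2 ℕ.+ k} (s≤s (s≤s z≤n))) ⟩
    (2 ℕ.+ k) ℕ.* 0               ≡⟨ ℕ.*-zeroʳ (2 ℕ.+ k) ⟩
    0                             ≡⟨ cong (1 ℕ.*_) (k>n⇒nCk≡0 {0} {suc k} (s≤s z≤n)) ⟨
    1 ℕ.* (0 C suc k)             ∎
    where open ≡.≡-Reasoning
  [k+1]*[n+1]C[k+1]≡[n+1]*nCk (suc n) zero = begin
    1 ℕ.* (suc (suc n) C 1)   ≡⟨ ℕ.*-identityˡ (suc (suc n) C 1) ⟩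
    suc (suc n) C 1           ≡⟨ nC1≡n (suc (suc n)) ⟩
    suc (suc n)               ≡⟨ ℕ.*-identityʳ (suc (suc n)) ⟨
    suc (suc n) ℕ.* 1         ∎
    where open ≡.≡-Reasoning
  [k+1]*[n+1]C[k+1]≡[n+1]*nCk (suc n) (suc k) = begin
    suc (suc k) ℕ.* (suc (suc n) C suc (suc k))
      ≡⟨ cong (suc (suc k) ℕ.*_) (nCk+nC[k+1]≡[n+1]C[k+1] (suc n) (suc k)) ⟨
    suc (suc k) ℕ.* (B ℕ.+ C′)
      ≡⟨ solve 3 (λ k b c → (con 2 :+ k) :* (b :+ c) := ((con 1 :+ k) :* b :+ b) :+ (con 2 :+ k) :* c) refl k B C′ ⟩
    (suc k ℕ.* B ℕ.+ B) ℕ.+ suc (suc k) ℕ.* C′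
      ≡⟨ cong₂ (λ x y → (x ℕ.+ B) ℕ.+ y) ([k+1]*[n+1]C[k+1]≡[n+1]*nCk n k) ([k+1]*[n+1]C[k+1]≡[n+1]*nCk n (suc k)) ⟩
    (suc n ℕ.* (n C k) ℕ.+ B) ℕ.+ suc n ℕ.* (n C suc k)
      ≡⟨ solve 4 (λ n a b c → ((con 1 :+ n) :* a :+ b) :+ (con 1 :+ n) :* c := (con 1 :+ n) :* (a :+ c) :+ b) refl n (n C k) B (n C suc k) ⟩
    suc n ℕ.* ((n C k) ℕ.+ (n C suc k)) ℕ.+ B
      ≡⟨ cong (λ x → suc n ℕ.* x ℕ.+ B) (nCk+nC[k+1]≡[n+1]C[k+1] n k) ⟩
    suc n ℕ.* B ℕ.+ B
      ≡⟨ ℕ.+-comm (suc n ℕ.* B) B ⟩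
    suc (suc n) ℕ.* B ∎
    where
    open ≡.≡-Reasoning
    open ℕ-Solver.+-*-Solver
    B C′ : ℕ
    B  = suc n C suc k
    C′ = suc n C suc (suc k)

  p∣pC[k+1] : ∀ {q k} → Prime (suc q) → k ℕ.< q → suc q ℕ∣.∣ (suc q C suc k)
  p∣pC[k+1] {q} {k} p-prime k<q
    with euclidsLemma (suc k) (suc q C suc k) p-prime
           (≡.subst (suc q ℕ∣.∣_) (≡.sym ([k+1]*[n+1]C[k+1]≡[n+1]*nCk q k)) (ℕ∣.m∣m*n (q C k)))
  ... | inj₁ p∣k+1 = contradiction (ℕ∣.∣⇒≤ p∣k+1) (ℕ.<⇒≱ (s≤s k<q))
  ... | inj₂ p∣C   = p∣C

  module Frobenius (S : CommutativeSemiring c ℓ) where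
    open CommutativeSemiring S renaming (refl to ≈-refl; sym to ≈-sym; trans to ≈-trans)
    open import Algebra.Properties.Semiring.Mult semiring
      using (×-assoc-*; ×-congʳ; ×-assocˡ; ×-congˡ) renaming (_×_ to _·_)
    open import Algebra.Properties.CommutativeSemiring.Exp S using (_^_; ^-congˡ; ^-assocʳ)
    open import Algebra.Properties.Semiring.Sum semiring using (sum; sum-cong-≋; sum-init-last; sum-replicate-zero)
    open import Algebra.Properties.CommutativeSemiring.Binomial S using (theorem; binomialTerm)
    open import Relation.Binary.Reasoning.Setoid setoid

    multiple-vanishes : ∀ {p m} → p · 1# ≈ 0# → p ℕ∣.∣ m → ∀ x → m · x ≈ 0#
    multiple-vanishes {p} {m} p·1≈0 (ℕ∣.divides q m≡qp) x = begin
      m · x               ≈⟨ ×-congˡ (≡.trans m≡qp (ℕ.*-comm q p)) ⟩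
      (p ℕ.* q) · x       ≈⟨ ×-assocˡ x p q ⟨
      p · (q · x)         ≈⟨ ×-congʳ p (*-identityˡ (q · x)) ⟨
      p · (1# * (q · x))  ≈⟨ ×-assoc-* p 1# (q · x) ⟨
      (p · 1#) * (q · x)  ≈⟨ *-congʳ p·1≈0 ⟩
      0# * (q · x)        ≈⟨ zeroˡ (q · x) ⟩
      0#                  ∎

    -- Only the two outer terms of the binomial theorem survive. The setting is a semiring so that
    -- the result serves both the quotients of ℤ[ζ] and the group semiring over them.
    ^p-homo-+ : ∀ {p} → Prime p → p · 1# ≈ 0# → ∀ x y → (x + y) ^ p ≈ x ^ p + y ^ p
    ^p-homo-+ {zero}  p₀ with () ← prime⇒nonZero p₀
    ^p-homo-+ {suc q} p-prime p·1≈0 x y = begin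
      (x + y) ^ p
        ≈⟨ theorem p x y ⟩
      sum (term p)
        ≈⟨ +-congˡ (sum-init-last (λ k → term p (Fin.suc k))) ⟩
      term p Fin.zero + (sum (λ k → term p (Fin.suc (inject₁ k))) + term p (Fin.suc (fromℕ q)))
        ≈⟨ +-cong first (+-cong (≈-trans (sum-cong-≋ middle) (sum-replicate-zero q)) last) ⟩
      y ^ p + (0# + x ^ p)
        ≈⟨ +-congˡ (+-identityˡ (x ^ p)) ⟩
      y ^ p + x ^ p
        ≈⟨ +-comm (y ^ p) (x ^ p) ⟩
      x ^ p + y ^ p ∎
      where
      p = suc q
      term = binomialTerm x y
      first : term p Fin.zero ≈ y ^ p
      first = ≈-trans (+-identityʳ _) (*-identityˡ (y ^ p))
      middle : ∀ k → term p (Fin.suc (inject₁ k)) ≈ 0#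
      middle k = multiple-vanishes p·1≈0
        (p∣pC[k+1] p-prime (≡.subst (ℕ._< q) (≡.sym (Fin.toℕ-inject₁ k)) (Fin.toℕ<n k))) _
      last : term p (Fin.suc (fromℕ q)) ≈ x ^ p
      last rewrite Fin.toℕ-fromℕ q | nCn≡1 p | ℕ.n∸n≡0 q =
        ≈-trans (+-identityʳ _) (*-identityʳ (x ^ p))

    ^pᵏ-homo-+ : ∀ {p} → Prime p → p · 1# ≈ 0# → ∀ k x y →
                 (x + y) ^ (p ℕ.^ k) ≈ x ^ (p ℕ.^ k) + y ^ (p ℕ.^ k)
    ^pᵏ-homo-+ p-prime p·1≈0 zero x y =
      ≈-trans (*-identityʳ (x + y)) (+-cong (≈-sym (*-identityʳ x)) (≈-sym (*-identityʳ y)))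
    ^pᵏ-homo-+ {p} p-prime p·1≈0 (suc k) x y = begin
      (x + y) ^ (p ℕ.* q)             ≈⟨ ^-assocʳ (x + y) p q ⟨
      ((x + y) ^ p) ^ q               ≈⟨ ^-congˡ q (^p-homo-+ p-prime p·1≈0 x y) ⟩
      (x ^ p + y ^ p) ^ q             ≈⟨ ^pᵏ-homo-+ p-prime p·1≈0 k (x ^ p) (y ^ p) ⟩
      (x ^ p) ^ q + (y ^ p) ^ q       ≈⟨ +-cong (^-assocʳ x p q) (^-assocʳ y p q) ⟩
      x ^ (p ℕ.* q) + y ^ (p ℕ.* q)   ∎
      where q = p ℕ.^ k

    ^p-homo-sum : ∀ {p} → Prime p → p · 1# ≈ 0# → ∀ {n} (f : Fin n → Carrier) →
                  sum f ^ p ≈ sum (λ i → f i ^ p)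
    ^p-homo-sum {suc q} p-prime p·1≈0 {zero}  f = zeroˡ (0# ^ q)
    ^p-homo-sum {zero}  p₀ with () ← prime⇒nonZero p₀
    ^p-homo-sum {p} p-prime p·1≈0 {suc n} f = ≈-trans
      (^p-homo-+ p-prime p·1≈0 (f Fin.zero) (sum (λ i → f (Fin.suc i))))
      (+-congˡ (^p-homo-sum p-prime p·1≈0 (λ i → f (Fin.suc i))))

  module FixedPoints (R : CommutativeRing c ℓ) where
    open CommutativeRing R renaming (refl to ≈-refl; sym to ≈-sym; trans to ≈-trans)
    open import Algebra.Properties.Semiring.Mult semiring renaming (_×_ to _·_)
    open import Algebra.Properties.CommutativeSemiring.Exp commutativeSemiring
    open import Algebra.Properties.Ring ring using (+-inverseʳ-unique)
    open Frobenius commutativeSemiring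

    1^n≈1 : ∀ n → 1# ^ n ≈ 1#
    1^n≈1 zero    = ≈-refl
    1^n≈1 (suc n) = ≈-trans (*-identityˡ _) (1^n≈1 n)

    module Power {p} (p-prime : Prime p) (p·1≈0 : p · 1# ≈ 0#) (k : ℕ) {j : ℕ} (pᵏ≡1+10j : p ℕ.^ k ≡ suc (10 ℕ.* j)) where
      private q = p ℕ.^ k

      -- For q = pᵏ the fixed elements form a subring, which contains the tenth roots of unity
      -- because q ≡ 1 modulo 10. In ℤ[ζ]/p it is therefore everything, however p splits.
      Fixed : Carrier → Set ℓ
      Fixed x = x ^ q ≈ x

      fixed-resp : ∀ {x y} → x ≈ y → Fixed x → Fixed y
      fixed-resp x≈y fx = ≈-trans (^-congˡ q (≈-sym x≈y)) (≈-trans fx x≈y)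

      fixed-+ : ∀ {x y} → Fixed x → Fixed y → Fixed (x + y)
      fixed-+ {x} {y} fx fy = ≈-trans (^pᵏ-homo-+ p-prime p·1≈0 k x y) (+-cong fx fy)

      fixed-* : ∀ {x y} → Fixed x → Fixed y → Fixed (x * y)
      fixed-* {x} {y} fx fy = ≈-trans (^-distrib-* x y q) (*-cong fx fy)

      fixed-0 : Fixed 0#
      fixed-0 rewrite pᵏ≡1+10j = zeroˡ (0# ^ (10 ℕ.* j))

      fixed-1 : Fixed 1#
      fixed-1 = 1^n≈1 q

      -- Since x + (-x)^q = (x - x)^q = 0, uniqueness of negatives determines (-x)^q, and the parity
      -- of q never enters.
      fixed-- : ∀ {x} → Fixed x → Fixed (- x)
      fixed-- {x} fx = +-inverseʳ-unique x ((- x) ^ q) (≈-trans (+-congʳ (≈-sym fx))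
        (≈-trans (≈-sym (^pᵏ-homo-+ p-prime p·1≈0 k x (- x)))
        (≈-trans (^-congˡ q (-‿inverseʳ x)) fixed-0)))

      fixed-root : ∀ {z} → z ^ 10 ≈ 1# → Fixed z
      fixed-root {z} z¹⁰≈1 rewrite pᵏ≡1+10j =
        ≈-trans (*-congˡ (≈-trans (≈-sym (^-assocʳ z 10 j)) (≈-trans (^-congˡ j z¹⁰≈1) (1^n≈1 j)))) (*-identityʳ z)

-- Roots of the tenth cyclotomic polynomial and powers of 5 dividing exponents

module OrdersOfUnits where
  open PrimeCharacteristic

  module _ (R : CommutativeRing c ℓ) where
    open CommutativeRing R using (_≈_; 1#; setoid; commutativeSemiring; *-identityˡ; *-identityʳ; *-assoc; *-comm; *-cong; *-congˡ; *-congʳ)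
      renaming (trans to ≈-trans; _*_ to _·_)
    open import Algebra.Properties.CommutativeSemiring.Exp commutativeSemiring renaming (_^_ to _⋆_)
    open FixedPoints R using (1^n≈1)
    open import Relation.Binary.Reasoning.Setoid setoid

    -- Raising to the power e turns h¹⁰ into h¹⁰ᵉ = 1 and, since 10 ∣ e, removes the root of unity z.
    e-th-power : ∀ {a b h h⁻¹ w z z⁻¹} e f → e ≡ 10 ℕ.* f →
                 b · w ≈ z · (a · h ⋆ 10) → z ⋆ 10 ≈ 1# → z · z⁻¹ ≈ 1# → w ⋆ e · z ≈ 1# →
                 h ⋆ suc (10 ℕ.* e) ≈ h → h · h⁻¹ ≈ 1# →
                 a ⋆ e ≈ b ⋆ e · z⁻¹
    e-th-power {a} {b} {h} {h⁻¹} {w} {z} {z⁻¹} e f e≡10f bw≈zah¹⁰ z¹⁰≈1 zz⁻¹≈1 wᵉz≈1 h-fixed hh⁻¹≈1 = begin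
      a ⋆ e                                   ≈⟨ *-identityʳ _ ⟨
      a ⋆ e · 1#                              ≈⟨ *-cong bᵉwᵉ≈aᵉ zz⁻¹≈1 ⟨
      b ⋆ e · w ⋆ e · (z · z⁻¹)               ≈⟨ *-assoc _ _ _ ⟩
      b ⋆ e · (w ⋆ e · (z · z⁻¹))             ≈⟨ *-congˡ (*-assoc _ _ _) ⟨
      b ⋆ e · (w ⋆ e · z · z⁻¹)               ≈⟨ *-congˡ (*-congʳ wᵉz≈1) ⟩
      b ⋆ e · (1# · z⁻¹)                      ≈⟨ *-congˡ (*-identityˡ _) ⟩
      b ⋆ e · z⁻¹                             ∎
      where
      h^10e≈1 : h ⋆ (10 ℕ.* e) ≈ 1#
      h^10e≈1 = begin
        h ⋆ (10 ℕ.* e)                ≈⟨ *-identityʳ _ ⟨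
        h ⋆ (10 ℕ.* e) · 1#           ≈⟨ *-congˡ hh⁻¹≈1 ⟨
        h ⋆ (10 ℕ.* e) · (h · h⁻¹)    ≈⟨ *-assoc _ _ _ ⟨
        h ⋆ (10 ℕ.* e) · h · h⁻¹      ≈⟨ *-congʳ (*-comm _ _) ⟩
        h ⋆ suc (10 ℕ.* e) · h⁻¹      ≈⟨ *-congʳ h-fixed ⟩
        h · h⁻¹                       ≈⟨ hh⁻¹≈1 ⟩
        1#                            ∎
      zᵉ≈1 : z ⋆ e ≈ 1#
      zᵉ≈1 = begin
        z ⋆ e              ≡⟨ cong (z ⋆_) e≡10f ⟩
        z ⋆ (10 ℕ.* f)     ≈⟨ ^-assocʳ z 10 f ⟨
        (z ⋆ 10) ⋆ f       ≈⟨ ^-congˡ f z¹⁰≈1 ⟩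
        1# ⋆ f             ≈⟨ 1^n≈1 f ⟩
        1#                 ∎
      bᵉwᵉ≈aᵉ : b ⋆ e · w ⋆ e ≈ a ⋆ e
      bᵉwᵉ≈aᵉ = begin
        b ⋆ e · w ⋆ e                    ≈⟨ ^-distrib-* b w e ⟨
        (b · w) ⋆ e                      ≈⟨ ^-congˡ e bw≈zah¹⁰ ⟩
        (z · (a · h ⋆ 10)) ⋆ e           ≈⟨ ^-distrib-* _ _ e ⟩
        z ⋆ e · (a · h ⋆ 10) ⋆ e         ≈⟨ *-cong zᵉ≈1 (^-distrib-* _ _ e) ⟩
        1# · (a ⋆ e · (h ⋆ 10) ⋆ e)      ≈⟨ *-identityˡ _ ⟩
        a ⋆ e · (h ⋆ 10) ⋆ e             ≈⟨ *-congˡ (≈-trans (^-assocʳ h 10 e) h^10e≈1) ⟩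
        a ⋆ e · 1#                       ≈⟨ *-identityʳ _ ⟩
        a ⋆ e                            ∎

  ^-distribʳ-* : ∀ m n k → (m ℕ.* n) ℕ.^ k ≡ m ℕ.^ k ℕ.* n ℕ.^ k
  ^-distribʳ-* m n zero    = refl
  ^-distribʳ-* m n (suc k) = ≡.trans (cong (m ℕ.* n ℕ.*_) (^-distribʳ-* m n k))
    (ℕ.[m*n]*[o*p]≡[m*o]*[n*p] m n (m ℕ.^ k) (n ℕ.^ k))

  prime∤⇒pʳ∣ : ∀ {p} → Prime p → ∀ r {g h} → ¬ (p ℕ∣.∣ h) → p ℕ.^ r ℕ∣.∣ g ℕ.* h → p ℕ.^ r ℕ∣.∣ g
  prime∤⇒pʳ∣ p-prime zero p∤h _ = ℕ∣.1∣ _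
  prime∤⇒pʳ∣ {p} p-prime (suc r) {g} {h} p∤h pʳ⁺¹∣gh
    with euclidsLemma g h p-prime (ℕ∣.∣-trans (ℕ∣.m∣m*n (p ℕ.^ r)) pʳ⁺¹∣gh)
  ... | inj₂ p∣h = contradiction p∣h p∤h
  ... | inj₁ (ℕ∣.divides g′ refl) =
    ≡.subst (p ℕ.* p ℕ.^ r ℕ∣.∣_) (ℕ.*-comm p g′)
      (ℕ∣.*-monoʳ-∣ p (prime∤⇒pʳ∣ p-prime r p∤h
        (ℕ∣.*-cancelˡ-∣ p {{prime⇒nonZero p-prime}} (≡.subst (p ℕ.* p ℕ.^ r ℕ∣.∣_) eq pʳ⁺¹∣gh))))
    where
    eq : g′ ℕ.* p ℕ.* h ≡ p ℕ.* (g′ ℕ.* h)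
    eq = ≡.trans (cong (ℕ._* h) (ℕ.*-comm g′ p)) (ℕ.*-assoc p g′ h)

  module Order (R : CommutativeRing c ℓ) where
    open CommutativeRing R renaming (refl to ≈-refl; sym to ≈-sym; trans to ≈-trans; _*_ to _·_)
    open import Algebra.Properties.CommutativeSemiring.Exp commutativeSemiring renaming (_^_ to _⋆_)
    open import Algebra.Properties.Ring ring using (+-cancelʳ)
    open import Algebra.Properties.Semiring.Mult semiring using () renaming (_×_ to _×ℕ_)
    open import Algebra.Properties.CommutativeSemigroup *-commutativeSemigroup using (interchange)
    open import Algebra.Solver.Ring.NaturalCoefficients.Default commutativeSemiring
    open FixedPoints R using (1^n≈1)
    open import Relation.Binary.Reasoning.Setoid setoid

    ∣⇒^≈1 : ∀ {x m n} → m ℕ∣.∣ n → x ⋆ m ≈ 1# → x ⋆ n ≈ 1#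
    ∣⇒^≈1 {x} {m} {n} (ℕ∣.divides q n≡qm) xᵐ≈1 = begin
      x ⋆ n            ≡⟨ cong (x ⋆_) (≡.trans n≡qm (ℕ.*-comm q m)) ⟩
      x ⋆ (m ℕ.* q)    ≈⟨ ^-assocʳ x m q ⟨
      (x ⋆ m) ⋆ q      ≈⟨ ^-congˡ q xᵐ≈1 ⟩
      1# ⋆ q           ≈⟨ 1^n≈1 q ⟩
      1#               ∎

    +⇒^≈1 : ∀ {x} a b → x ⋆ b ≈ 1# → x ⋆ (a ℕ.+ b) ≈ 1# → x ⋆ a ≈ 1#
    +⇒^≈1 {x} a b xᵇ≈1 xᵃ⁺ᵇ≈1 = begin
      x ⋆ a            ≈⟨ *-identityʳ _ ⟨
      x ⋆ a · 1#       ≈⟨ *-congˡ xᵇ≈1 ⟨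
      x ⋆ a · x ⋆ b    ≈⟨ ^-homo-* x a b ⟨
      x ⋆ (a ℕ.+ b)    ≈⟨ xᵃ⁺ᵇ≈1 ⟩
      1#               ∎

    -- Bézout over the naturals reads gcd + bn = am or gcd + am = bn. Cancelling an exponent that
    -- already gives 1 replaces negative powers.
    gcd⇒^≈1 : ∀ {x} m n → x ⋆ m ≈ 1# → x ⋆ n ≈ 1# → x ⋆ gcd m n ≈ 1#
    gcd⇒^≈1 {x} m n xᵐ≈1 xⁿ≈1 with Bézout.identity (gcd-GCD m n)
    ... | Bézout.+- a b eq = +⇒^≈1 (gcd m n) (b ℕ.* n) (∣⇒^≈1 (ℕ∣.n∣m*n b) xⁿ≈1)
      (≈-trans (reflexive (cong (x ⋆_) eq)) (∣⇒^≈1 (ℕ∣.n∣m*n a) xᵐ≈1))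
    ... | Bézout.-+ a b eq = +⇒^≈1 (gcd m n) (a ℕ.* m) (∣⇒^≈1 (ℕ∣.n∣m*n a) xᵐ≈1)
      (≈-trans (reflexive (cong (x ⋆_) eq)) (∣⇒^≈1 (ℕ∣.n∣m*n b) xⁿ≈1))

    module TenthRoot {y ȳ a₂} (yȳ≈1 : y · ȳ ≈ 1#) (sum≈1 : (y + ȳ) + a₂ ≈ 1#) (product≈-1 : (y + ȳ) · a₂ ≈ - 1#) where
      private a₁ = y + ȳ

      -- Vieta: `a₁` and `a₂` have the sum and product of the roots of X² - X - 1, which in ℤ[ζ] are
      -- ζ + ζ⁻¹ and ζ³ + ζ⁻³.
      a₁²≈a₁+1 : a₁ · a₁ ≈ a₁ + 1#
      a₁²≈a₁+1 = +-cancelʳ (a₁ · a₂) (a₁ · a₁) (a₁ + 1#) (begin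
        a₁ · a₁ + a₁ · a₂         ≈⟨ distribˡ a₁ a₁ a₂ ⟨
        a₁ · (a₁ + a₂)            ≈⟨ *-congˡ sum≈1 ⟩
        a₁ · 1#                   ≈⟨ *-identityʳ a₁ ⟩
        a₁                        ≈⟨ +-identityʳ a₁ ⟨
        a₁ + 0#                   ≈⟨ +-congˡ (-‿inverseʳ 1#) ⟨
        a₁ + (1# + - 1#)          ≈⟨ +-assoc a₁ 1# (- 1#) ⟨
        a₁ + 1# + - 1#            ≈⟨ +-congˡ product≈-1 ⟨
        a₁ + 1# + a₁ · a₂         ∎)

      -- This eliminates ȳ. Squaring it and substituting for `a₁` squared leaves a quartic in y
      -- alone.
      ya₁≈y²+1 : y · a₁ ≈ y · y + 1#
      ya₁≈y²+1 = ≈-trans (distribˡ y y ȳ) (+-congˡ yȳ≈1)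

      -- Φ₁₀(y) = 0 with the negative terms moved to the right
      Φ₁₀ : y ⋆ 4 + y ⋆ 2 + 1# ≈ y ⋆ 3 + y
      Φ₁₀ = +-cancelʳ (y · y) _ _ (begin
        y ⋆ 4 + y ⋆ 2 + 1# + y · y
          ≈⟨ solve 1 (λ y → y :^ 4 :+ y :^ 2 :+ con 1 :+ y :* y := (y :* y :+ con 1) :* (y :* y :+ con 1)) ≈-refl y ⟩
        (y · y + 1#) · (y · y + 1#)   ≈⟨ *-cong ya₁≈y²+1 ya₁≈y²+1 ⟨
        (y · a₁) · (y · a₁)           ≈⟨ interchange y a₁ y a₁ ⟩
        (y · y) · (a₁ · a₁)           ≈⟨ *-congˡ a₁²≈a₁+1 ⟩
        (y · y) · (a₁ + 1#)           ≈⟨ solve 2 (λ y a → (y :* y) :* (a :+ con 1) := y :* (y :* a) :+ y :* y) ≈-refl y a₁ ⟩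
        y · (y · a₁) + y · y          ≈⟨ +-congʳ (*-congˡ ya₁≈y²+1) ⟩
        y · (y · y + 1#) + y · y      ≈⟨ solve 1 (λ y → y :* (y :* y :+ con 1) :+ y :* y := y :^ 3 :+ y :+ y :* y) ≈-refl y ⟩
        y ⋆ 3 + y + y · y             ∎)

      -- The factorisation y⁵ + 1 = (y + 1) Φ₁₀(y), arranged without subtraction to suit a semiring
      -- solver.
      y⁵+1≈0 : y ⋆ 5 + 1# ≈ 0#
      y⁵+1≈0 = +-cancelʳ (y ⋆ 3 + y) _ _ (begin
        y ⋆ 5 + 1# + (y ⋆ 3 + y)
          ≈⟨ solve 1 (λ y → y :^ 5 :+ con 1 :+ (y :^ 3 :+ y) := y :* (y :^ 4 :+ y :^ 2 :+ con 1) :+ con 1) ≈-refl y ⟩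
        y · (y ⋆ 4 + y ⋆ 2 + 1#) + 1#   ≈⟨ +-congʳ (*-congˡ Φ₁₀) ⟩
        y · (y ⋆ 3 + y) + 1#
          ≈⟨ solve 1 (λ y → y :* (y :^ 3 :+ y) :+ con 1 := y :^ 4 :+ y :^ 2 :+ con 1) ≈-refl y ⟩
        y ⋆ 4 + y ⋆ 2 + 1#              ≈⟨ Φ₁₀ ⟩
        y ⋆ 3 + y                       ≈⟨ +-identityˡ _ ⟨
        0# + (y ⋆ 3 + y)                ∎)

      y¹⁰≈1 : y ⋆ 10 ≈ 1#
      y¹⁰≈1 = +-cancelʳ (y ⋆ 5) _ _ (begin
        y ⋆ 10 + y ⋆ 5          ≈⟨ solve 1 (λ y → y :^ 10 :+ y :^ 5 := y :^ 5 :* (y :^ 5 :+ con 1)) ≈-refl y ⟩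
        y ⋆ 5 · (y ⋆ 5 + 1#)    ≈⟨ *-congˡ y⁵+1≈0 ⟩
        y ⋆ 5 · 0#              ≈⟨ zeroʳ _ ⟩
        0#                      ≈⟨ y⁵+1≈0 ⟨
        y ⋆ 5 + 1#              ≈⟨ +-comm _ _ ⟩
        1# + y ⋆ 5              ∎)

      -- From y² = 1 and y⁵ = -1 follows y = -1, and Φ₁₀(-1) = 5. The 2 added to both sides turns y³
      -- + y into twice y + 1.
      y²≈1⇒5≈0 : y ⋆ 2 ≈ 1# → 5 ×ℕ 1# ≈ 0#
      y²≈1⇒5≈0 y²≈1 = begin
        5 ×ℕ 1#
          ≈⟨ solve 0 (con 1 :+ (con 1 :+ (con 1 :+ (con 1 :+ (con 1 :+ con 0)))) := con 1 :* con 1 :+ con 1 :+ con 1 :+ (con 1 :+ (con 1 :+ con 0))) ≈-refl ⟩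
        1# · 1# + 1# + 1# + (1# + (1# + 0#))                  ≈⟨ +-congʳ (+-congʳ (+-cong (*-cong y²≈1 y²≈1) y²≈1)) ⟨
        y ⋆ 2 · y ⋆ 2 + y ⋆ 2 + 1# + (1# + (1# + 0#))
          ≈⟨ +-congʳ (+-congʳ (+-congʳ (^-homo-* y 2 2))) ⟨
        y ⋆ 4 + y ⋆ 2 + 1# + (1# + (1# + 0#))         ≈⟨ +-congʳ Φ₁₀ ⟩
        y ⋆ 3 + y + (1# + (1# + 0#))
          ≈⟨ solve 1 (λ y → y :^ 3 :+ y :+ (con 1 :+ (con 1 :+ con 0)) := y :* y :^ 2 :+ con 1 :+ (y :+ con 1)) ≈-refl y ⟩
        y · y ⋆ 2 + 1# + (y + 1#)                     ≈⟨ +-congʳ (+-congʳ (≈-trans (*-congˡ y²≈1) (*-identityʳ y))) ⟩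
        (y + 1#) + (y + 1#)                           ≈⟨ +-cong y+1≈0 y+1≈0 ⟩
        0# + 0#                                       ≈⟨ +-identityˡ 0# ⟩
        0#                                            ∎
        where
        y+1≈0 : y + 1# ≈ 0#
        y+1≈0 = begin
          y + 1#                          ≈⟨ +-congʳ (*-identityʳ y) ⟨
          y · 1# + 1#                     ≈⟨ +-congʳ (*-congˡ (*-identityʳ 1#)) ⟨
          y · (1# · 1#) + 1#              ≈⟨ +-congʳ (*-congˡ (*-cong y²≈1 y²≈1)) ⟨
          y · (y ⋆ 2 · y ⋆ 2) + 1#        ≈⟨ +-congʳ (*-congˡ (^-homo-* y 2 2)) ⟨
          y ⋆ 5 + 1#                      ≈⟨ y⁵+1≈0 ⟩
          0#                              ∎

    -- If 5ʳ ∤ m, then gcd(m, 10ʳ) divides 2·10ʳ⁻¹, so that y² = 1, which together with Φ₁₀(y) = 0 gives 5 = 0.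
    5ʳ∣order : ∀ {x x̄ a₂ m} s → (let e = 10 ℕ.^ s) → x ⋆ m ≈ 1# → x ⋆ e · x̄ ⋆ e ≈ 1# →
               (x ⋆ e + x̄ ⋆ e) + a₂ ≈ 1# → (x ⋆ e + x̄ ⋆ e) · a₂ ≈ - 1# →
               ¬ (5 ×ℕ 1# ≈ 0#) → 5 ℕ.^ suc s ℕ∣.∣ m
    5ʳ∣order {x} {x̄} {a₂} {m} s xᵐ≈1 yȳ≈1 sum≈1 product≈-1 5≉0
      with gcd[m,n]∣n m (10 ℕ.^ suc s)
    ... | ℕ∣.divides h 10ʳ≡hg with 5 ℕ∣.∣? h
    ...   | no 5∤h = ℕ∣.∣-trans (prime∤⇒pʳ∣ 5-prime (suc s) 5∤h 5ʳ∣gh) (gcd[m,n]∣m m (10 ℕ.^ suc s))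
      where
      5-prime : Prime 5
      5-prime = from-yes (prime? 5)
      5ʳ∣gh : 5 ℕ.^ suc s ℕ∣.∣ gcd m (10 ℕ.^ suc s) ℕ.* h
      5ʳ∣gh = ≡.subst (5 ℕ.^ suc s ℕ∣.∣_)
        (≡.trans (≡.sym (^-distribʳ-* 5 2 (suc s))) (≡.trans 10ʳ≡hg (ℕ.*-comm h _)))
        (ℕ∣.m∣m*n (2 ℕ.^ suc s))
    ...   | yes (ℕ∣.divides h′ h≡5h′) = contradiction (y²≈1⇒5≈0 y²≈1) 5≉0
      where
      open TenthRoot yȳ≈1 sum≈1 product≈-1
      e = 10 ℕ.^ s
      g = gcd m (10 ℕ.^ suc s)
      x^10ʳ≈1 : x ⋆ (10 ℕ.^ suc s) ≈ 1#
      x^10ʳ≈1 = ≈-trans (reflexive (cong (x ⋆_) (ℕ.*-comm 10 e)))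
        (≈-trans (≈-sym (^-assocʳ x e 10)) y¹⁰≈1)
      e*2≡h′g : e ℕ.* 2 ≡ h′ ℕ.* g
      e*2≡h′g = ℕ.*-cancelˡ-≡ (e ℕ.* 2) (h′ ℕ.* g) 5 (≡.trans (cong (5 ℕ.*_) (ℕ.*-comm e 2)) (≡.trans (≡.sym (ℕ.*-assoc 5 2 e))
        (≡.trans 10ʳ≡hg (≡.trans (cong (ℕ._* g) (≡.trans h≡5h′ (ℕ.*-comm h′ 5))) (ℕ.*-assoc 5 h′ g)))))
      y²≈1 : (x ⋆ e) ⋆ 2 ≈ 1#
      y²≈1 = ≈-trans (^-assocʳ x e 2)
        (∣⇒^≈1 (ℕ∣.divides h′ e*2≡h′g) (gcd⇒^≈1 m (10 ℕ.^ suc s) xᵐ≈1 x^10ʳ≈1))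

    -- The previous result with denominators cleared. It is applied to a = 11³ α, b = 11³ and v an
    -- inverse of b, so that x = va is the reduction of α; multiplying by vᵉ recovers the sum 1 and
    -- the product -1.
    5ʳ∣ : ∀ {a ā b v a₂ m} s → (let e = 10 ℕ.^ s) → (∀ x → x ⋆ suc m ≈ x) → a · ā ≈ b · b → b · v ≈ 1# →
          (a ⋆ e + ā ⋆ e) + a₂ ≈ b ⋆ e → (a ⋆ e + ā ⋆ e) · a₂ ≈ (b ⋆ e · b ⋆ e) · - 1# →
          ¬ (5 ×ℕ 1# ≈ 0#) → 5 ℕ.^ suc s ℕ∣.∣ m
    5ʳ∣ {a} {ā} {b} {v} {a₂} {m} s x^[m+1]≈x aā≈bb bv≈1 sum≈bᵉ product≈-b²ᵉ =
      5ʳ∣order {x} {x̄} {u · a₂} s xᵐ≈1 yȳ≈1 sum≈1 product≈-1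
      where
      e = 10 ℕ.^ s
      x = v · a
      x̄ = v · ā
      u = v ⋆ e
      xx̄≈1 : x · x̄ ≈ 1#
      xx̄≈1 = begin
        (v · a) · (v · ā)    ≈⟨ interchange v a v ā ⟩
        (v · v) · (a · ā)    ≈⟨ *-congˡ aā≈bb ⟩
        (v · v) · (b · b)    ≈⟨ interchange v v b b ⟩
        (v · b) · (v · b)    ≈⟨ *-cong (≈-trans (*-comm v b) bv≈1) (≈-trans (*-comm v b) bv≈1) ⟩
        1# · 1#              ≈⟨ *-identityˡ 1# ⟩
        1#                   ∎
      xᵐ≈1 : x ⋆ m ≈ 1#
      xᵐ≈1 = begin
        x ⋆ m                ≈⟨ *-identityʳ _ ⟨
        x ⋆ m · 1#           ≈⟨ *-congˡ xx̄≈1 ⟨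
        x ⋆ m · (x · x̄)      ≈⟨ *-assoc _ _ _ ⟨
        x ⋆ m · x · x̄        ≈⟨ *-congʳ (*-comm _ _) ⟩
        x ⋆ suc m · x̄        ≈⟨ *-congʳ (x^[m+1]≈x x) ⟩
        x · x̄                ≈⟨ xx̄≈1 ⟩
        1#                   ∎
      yȳ≈1 : x ⋆ e · x̄ ⋆ e ≈ 1#
      yȳ≈1 = ≈-trans (≈-sym (^-distrib-* x x̄ e)) (≈-trans (^-congˡ e xx̄≈1) (1^n≈1 e))
      ubᵉ≈1 : u · b ⋆ e ≈ 1#
      ubᵉ≈1 = ≈-trans (≈-sym (^-distrib-* v b e)) (≈-trans (^-congˡ e (≈-trans (*-comm v b) bv≈1)) (1^n≈1 e))
      y+ȳ≈ : x ⋆ e + x̄ ⋆ e ≈ u · (a ⋆ e + ā ⋆ e)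
      y+ȳ≈ = ≈-trans (+-cong (^-distrib-* v a e) (^-distrib-* v ā e)) (≈-sym (distribˡ u (a ⋆ e) (ā ⋆ e)))
      sum≈1 : (x ⋆ e + x̄ ⋆ e) + u · a₂ ≈ 1#
      sum≈1 = begin
        (x ⋆ e + x̄ ⋆ e) + u · a₂            ≈⟨ +-congʳ y+ȳ≈ ⟩
        u · (a ⋆ e + ā ⋆ e) + u · a₂        ≈⟨ distribˡ u _ a₂ ⟨
        u · ((a ⋆ e + ā ⋆ e) + a₂)          ≈⟨ *-congˡ sum≈bᵉ ⟩
        u · b ⋆ e                           ≈⟨ ubᵉ≈1 ⟩
        1#                                  ∎
      product≈-1 : (x ⋆ e + x̄ ⋆ e) · (u · a₂) ≈ - 1#
      product≈-1 = begin
        (x ⋆ e + x̄ ⋆ e) · (u · a₂)                ≈⟨ *-congʳ y+ȳ≈ ⟩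
        (u · (a ⋆ e + ā ⋆ e)) · (u · a₂)          ≈⟨ interchange u _ u a₂ ⟩
        (u · u) · ((a ⋆ e + ā ⋆ e) · a₂)          ≈⟨ *-congˡ product≈-b²ᵉ ⟩
        (u · u) · ((b ⋆ e · b ⋆ e) · - 1#)        ≈⟨ *-assoc _ _ _ ⟨
        (u · u) · (b ⋆ e · b ⋆ e) · - 1#          ≈⟨ *-congʳ (interchange u u (b ⋆ e) (b ⋆ e)) ⟩
        (u · b ⋆ e) · (u · b ⋆ e) · - 1#          ≈⟨ *-congʳ (*-cong ubᵉ≈1 ubᵉ≈1) ⟩
        1# · 1# · - 1#                            ≈⟨ *-congʳ (*-identityˡ 1#) ⟩
        1# · - 1#                                 ≈⟨ *-identityˡ _ ⟩
        - 1#                                      ∎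

-- The ring ℤ[ζ] and its quotients by rational integers

module CyclotomicIntegers where
  open PrimeCharacteristic

  -- a₀ + a₁ ζ + a₂ ζ² + a₃ ζ³ with ζ = ζ₁₀
  record Quad (A : Set) : Set where
    constructor ⟪_,_,_,_⟫
    field
      c₀ c₁ c₂ c₃ : A

  open Quad public

  -- The operations are taken over an arbitrary type so that the same formulas serve for integers and for
  -- the polynomials of the ring solvers.
  module QuadOps {A : Set} (_+_ _*_ : A → A → A) (-_ : A → A) where
    infixl 6 _⊞_
    infixl 7 _⊠_
    infix  8 ⊟_

    private
      _-_ : A → A → A
      x - y = x + (- y)

    _⊞_ _⊠_ : Quad A → Quad A → Quad A
    ⟪ a₀ , a₁ , a₂ , a₃ ⟫ ⊞ ⟪ b₀ , b₁ , b₂ , b₃ ⟫ = ⟪ a₀ + b₀ , a₁ + b₁ , a₂ + b₂ , a₃ + b₃ ⟫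
    ⟪ a₀ , a₁ , a₂ , a₃ ⟫ ⊠ ⟪ b₀ , b₁ , b₂ , b₃ ⟫ =
      ⟪ ((a₀ * b₀) - e₄) - e₅ , (((a₀ * b₁) + (a₁ * b₀)) + e₄) - e₆
      , (((a₀ * b₂) + (a₁ * b₁)) + (a₂ * b₀)) - e₄
      , ((((a₀ * b₃) + (a₁ * b₂)) + (a₂ * b₁)) + (a₃ * b₀)) + e₄ ⟫
      where
      e₄ e₅ e₆ : A
      e₄ = ((a₁ * b₃) + (a₂ * b₂)) + (a₃ * b₁)
      e₅ = (a₂ * b₃) + (a₃ * b₂)
      e₆ = a₃ * b₃

    -- The images of ζ, ζ², ζ³ are ζ³, ζ⁶, ζ⁹ under σ₃ and ζ⁹, ζ⁸, ζ⁷ under conjugation, where ζ⁶ =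
    -- -ζ, ζ⁷ = -ζ², ζ⁸ = -ζ³ and ζ⁹ = 1 - ζ + ζ² - ζ³.
    ⊟_ σ₃ᵠ conjᵠ : Quad A → Quad A
    ⊟ ⟪ a₀ , a₁ , a₂ , a₃ ⟫ = ⟪ - a₀ , - a₁ , - a₂ , - a₃ ⟫
    σ₃ᵠ ⟪ a₀ , a₁ , a₂ , a₃ ⟫ = ⟪ a₀ + a₃ , - (a₂ + a₃) , a₃ , a₁ - a₃ ⟫
    conjᵠ ⟪ a₀ , a₁ , a₂ , a₃ ⟫ = ⟪ a₀ + a₁ , - a₁ , a₁ - a₃ , - (a₁ + a₂) ⟫

  ≡-by-coeffs : ∀ {A : Set} {x y : Quad A} → c₀ x ≡ c₀ y → c₁ x ≡ c₁ y → c₂ x ≡ c₂ y → c₃ x ≡ c₃ y → x ≡ y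
  ≡-by-coeffs refl refl refl refl = refl

  ℤ[ζ] : Set
  ℤ[ζ] = Quad ℤ

  open QuadOps ℤ._+_ ℤ._*_ ℤ.-_ public renaming (_⊞_ to _+_; _⊠_ to _*_; ⊟_ to -_; σ₃ᵠ to σ₃; conjᵠ to conj)

  const : ℤ → ℤ[ζ]
  const a = ⟪ a , 0ℤ , 0ℤ , 0ℤ ⟫

  ζ : ℤ[ζ]
  ζ = ⟪ 0ℤ , 1ℤ , 0ℤ , 0ℤ ⟫

  module _ where
    open ℤ-Solver.+-*-Solver
    module QuadPolynomials {n : ℕ} = QuadOps {Polynomial n} _:+_ _:*_ (λ x → :- x)
    open QuadPolynomials

    private
      var⁴ : ∀ {n} → Fin n → Fin n → Fin n → Fin n → Quad (Polynomial n)
      var⁴ i j k l = ⟪ var i , var j , var k , var l ⟫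

      constᵖ : ∀ {n} → Polynomial n → Quad (Polynomial n)
      constᵖ a = ⟪ a , con 0ℤ , con 0ℤ , con 0ℤ ⟫

      oneᵖ ζᵖ : ∀ {n} → Quad (Polynomial n)
      oneᵖ = constᵖ (con 1ℤ)
      ζᵖ = ⟪ con 0ℤ , con 1ℤ , con 0ℤ , con 0ℤ ⟫

      env : ∀ {n} → ℤ[ζ] → Vec ℤ n → Vec ℤ (4 ℕ.+ n)
      env ⟪ a₀ , a₁ , a₂ , a₃ ⟫ ρ = a₀ ∷ a₁ ∷ a₂ ∷ a₃ ∷ ρ

      X Y Z : ∀ {n} → Quad (Polynomial (4 ℕ.+ (4 ℕ.+ (4 ℕ.+ n))))
      X = var⁴ 0F 1F 2F 3F
      Y = var⁴ 4F 5F 6F 7F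
      Z = var⁴ 8F 9F (Fin.suc 9F) (Fin.suc (Fin.suc 9F))

      X₁ : ∀ {n} → Quad (Polynomial (4 ℕ.+ n))
      X₁ = var⁴ 0F 1F 2F 3F

      X₂ Y₂ : ∀ {n} → Quad (Polynomial (4 ℕ.+ (4 ℕ.+ n)))
      X₂ = var⁴ 0F 1F 2F 3F
      Y₂ = var⁴ 4F 5F 6F 7F

    +-assoc : ∀ x y z → (x + y) + z ≡ x + (y + z)
    +-assoc x y z = ≡-by-coeffs (ℤ.+-assoc (c₀ x) _ _) (ℤ.+-assoc (c₁ x) _ _) (ℤ.+-assoc (c₂ x) _ _) (ℤ.+-assoc (c₃ x) _ _)

    +-comm : ∀ x y → x + y ≡ y + x
    +-comm x y = ≡-by-coeffs (ℤ.+-comm (c₀ x) _) (ℤ.+-comm (c₁ x) _) (ℤ.+-comm (c₂ x) _) (ℤ.+-comm (c₃ x) _)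

    +-identityˡ : ∀ x → const 0ℤ + x ≡ x
    +-identityˡ x = ≡-by-coeffs (ℤ.+-identityˡ _) (ℤ.+-identityˡ _) (ℤ.+-identityˡ _) (ℤ.+-identityˡ _)

    -‿inverseʳ : ∀ x → x + - x ≡ const 0ℤ
    -‿inverseʳ x = ≡-by-coeffs (ℤ.+-inverseʳ (c₀ x)) (ℤ.+-inverseʳ (c₁ x)) (ℤ.+-inverseʳ (c₂ x)) (ℤ.+-inverseʳ (c₃ x))

    *-assoc : ∀ x y z → (x * y) * z ≡ x * (y * z)
    *-assoc x y z = ≡-by-coeffs (eq c₀ refl) (eq c₁ refl) (eq c₂ refl) (eq c₃ refl)
      where
      ρ = env x (env y (env z []))
      eq = λ (coeff : Quad (Polynomial 12) → Polynomial 12) →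
             prove ρ (coeff ((X ⊠ Y) ⊠ Z)) (coeff (X ⊠ (Y ⊠ Z)))

    *-comm : ∀ x y → x * y ≡ y * x
    *-comm x y = ≡-by-coeffs (eq c₀ refl) (eq c₁ refl) (eq c₂ refl) (eq c₃ refl)
      where
      ρ = env x (env y [])
      eq = λ (coeff : Quad (Polynomial 8) → Polynomial 8) →
             prove ρ (coeff (X₂ ⊠ Y₂)) (coeff (Y₂ ⊠ X₂))

    distribˡ : ∀ x y z → x * (y + z) ≡ x * y + x * z
    distribˡ x y z = ≡-by-coeffs (eq c₀ refl) (eq c₁ refl) (eq c₂ refl) (eq c₃ refl)
      where
      ρ = env x (env y (env z []))
      eq = λ (coeff : Quad (Polynomial 12) → Polynomial 12) →
             prove ρ (coeff (X ⊠ (Y ⊞ Z))) (coeff ((X ⊠ Y) ⊞ (X ⊠ Z)))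

    *-identityˡ : ∀ x → const 1ℤ * x ≡ x
    *-identityˡ x = ≡-by-coeffs (eq c₀ refl) (eq c₁ refl) (eq c₂ refl) (eq c₃ refl)
      where
      eq = λ (coeff : Quad (Polynomial 4) → Polynomial 4) →
             prove (env x []) (coeff (oneᵖ ⊠ X₁)) (coeff X₁)

    const-* : ∀ a x → const a * x ≡ ⟪ a ℤ.* c₀ x , a ℤ.* c₁ x , a ℤ.* c₂ x , a ℤ.* c₃ x ⟫
    const-* a x = ≡-by-coeffs (eq c₀ refl) (eq c₁ refl) (eq c₂ refl) (eq c₃ refl)
      where
      eq = λ (coeff : Quad (Polynomial 5) → Polynomial 5) →
             prove (env x (a ∷ [])) (coeff (constᵖ (var 4F) ⊠ X₁)) (var 4F :* coeff X₁)

    -- Horner's scheme: ζ and the integers generate the ring, so a property closed under sums and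
    -- products spreads from them to every element.
    expansion : ∀ x → x ≡ const (c₀ x) + ζ * (const (c₁ x) + ζ * (const (c₂ x) + ζ * const (c₃ x)))
    expansion x = ≡-by-coeffs (eq c₀ refl) (eq c₁ refl) (eq c₂ refl) (eq c₃ refl)
      where
      eq = λ (coeff : Quad (Polynomial 4) → Polynomial 4) →
             prove (env x []) (coeff X₁)
               (coeff (constᵖ (var 0F) ⊞ ζᵖ ⊠ (constᵖ (var 1F) ⊞ ζᵖ ⊠ (constᵖ (var 2F) ⊞ ζᵖ ⊠ constᵖ (var 3F)))))

    σ₃-* : ∀ x y → σ₃ (x * y) ≡ σ₃ x * σ₃ y
    σ₃-* x y = ≡-by-coeffs (eq c₀ refl) (eq c₁ refl) (eq c₂ refl) (eq c₃ refl)
      where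
      eq = λ (coeff : Quad (Polynomial 8) → Polynomial 8) →
             prove (env x (env y [])) (coeff (σ₃ᵠ (X₂ ⊠ Y₂))) (coeff (σ₃ᵠ X₂ ⊠ σ₃ᵠ Y₂))

    σ₃-+ : ∀ x y → σ₃ (x + y) ≡ σ₃ x + σ₃ y
    σ₃-+ x y = ≡-by-coeffs (eq c₀ refl) (eq c₁ refl) (eq c₂ refl) (eq c₃ refl)
      where
      eq = λ (coeff : Quad (Polynomial 8) → Polynomial 8) →
             prove (env x (env y [])) (coeff (σ₃ᵠ (X₂ ⊞ Y₂))) (coeff (σ₃ᵠ X₂ ⊞ σ₃ᵠ Y₂))

  ℤ[ζ]-isCommutativeRing : IsCommutativeRing _≡_ _+_ _*_ -_ (const 0ℤ) (const 1ℤ)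
  ℤ[ζ]-isCommutativeRing = record
    { isRing = record
      { +-isAbelianGroup = record
        { isGroup = record
          { isMonoid = record
            { isSemigroup = record
              { isMagma = record { isEquivalence = ≡.isEquivalence ; ∙-cong = cong₂ _+_ }
              ; assoc = +-assoc }
            ; identity = +-identityˡ , λ x → ≡.trans (+-comm x _) (+-identityˡ x) }
          ; inverse = (λ x → ≡.trans (+-comm (- x) x) (-‿inverseʳ x)) , -‿inverseʳ
          ; ⁻¹-cong = cong -_ }
        ; comm = +-comm }
      ; *-cong = cong₂ _*_
      ; *-assoc = *-assoc
      ; *-identity = *-identityˡ , λ x → ≡.trans (*-comm x _) (*-identityˡ x)
      ; distrib = distribˡ , λ x y z → ≡.trans (*-comm (y + z) x)
          (≡.trans (distribˡ x y z) (cong₂ _+_ (*-comm x y) (*-comm x z))) }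
    ; *-comm = *-comm }

  ℤ[ζ]-commutativeRing : CommutativeRing 0ℓ 0ℓ
  ℤ[ζ]-commutativeRing = record { isCommutativeRing = ℤ[ζ]-isCommutativeRing }

  open CommutativeRing ℤ[ζ]-commutativeRing using () renaming (semiring to ℤ[ζ]-semiring)
  open Exp ℤ[ζ]-semiring public using (_^_)

  module Quotient (R : CommutativeRing c ℓ) (m : CommutativeRing.Carrier R) where
    open CommutativeRing R using (Carrier; _≈_; 0#; 1#) renaming (_+_ to _⊕_; _*_ to _⊗_; -_ to ⊖_)
    private module R = CommutativeRing R
    open import Algebra.Properties.Ring R.ring using (-‿distribʳ-*; -‿+-comm)
    open import Relation.Binary.Reasoning.Setoid R.setoid
    open import Algebra.Properties.CommutativeSemigroup R.+-commutativeSemigroup using (interchange)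

    infix 4 _∼_

    -- The quotient keeps the carrier and the operations and only coarsens equality. Identities in
    -- ℤ[ζ], in particular those that hold by evaluation, thus hold modulo every m.
    record _∼_ (x y : Carrier) : Set (c ⊔ ℓ) where
      constructor _,_
      field
        multiplier : Carrier
        difference : x ≈ y ⊕ m ⊗ multiplier

    open _∼_ public

    ≈⇒∼ : ∀ {x y} → x ≈ y → x ∼ y
    ≈⇒∼ {x} {y} x≈y = 0# , (begin
      x            ≈⟨ x≈y ⟩
      y            ≈⟨ R.+-identityʳ y ⟨
      y ⊕ 0#       ≈⟨ R.+-congˡ (R.zeroʳ m) ⟨
      y ⊕ m ⊗ 0#   ∎)

    ∼-sym : ∀ {x y} → x ∼ y → y ∼ x
    ∼-sym {x} {y} (z , x≈y+mz) = ⊖ z , (begin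
      y                             ≈⟨ R.+-identityʳ y ⟨
      y ⊕ 0#                        ≈⟨ R.+-congˡ (R.-‿inverseʳ (m ⊗ z)) ⟨
      y ⊕ (m ⊗ z ⊕ ⊖ (m ⊗ z))       ≈⟨ R.+-assoc _ _ _ ⟨
      y ⊕ m ⊗ z ⊕ ⊖ (m ⊗ z)         ≈⟨ R.+-cong (R.sym x≈y+mz) (-‿distribʳ-* m z) ⟩
      x ⊕ m ⊗ (⊖ z)                 ∎)

    ∼-trans : ∀ {x y w} → x ∼ y → y ∼ w → x ∼ w
    ∼-trans {x} {y} {w} (z , x≈y+mz) (z′ , y≈w+mz′) = z′ ⊕ z , (begin
      x                        ≈⟨ x≈y+mz ⟩
      y ⊕ m ⊗ z                ≈⟨ R.+-congʳ y≈w+mz′ ⟩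
      w ⊕ m ⊗ z′ ⊕ m ⊗ z       ≈⟨ R.+-assoc _ _ _ ⟩
      w ⊕ (m ⊗ z′ ⊕ m ⊗ z)     ≈⟨ R.+-congˡ (R.distribˡ m z′ z) ⟨
      w ⊕ m ⊗ (z′ ⊕ z)         ∎)

    +-cong-∼ : ∀ {x y x′ y′} → x ∼ y → x′ ∼ y′ → x ⊕ x′ ∼ y ⊕ y′
    +-cong-∼ {x} {y} {x′} {y′} (z , x≈y+mz) (z′ , x′≈y′+mz′) = z ⊕ z′ , (begin
      x ⊕ x′                            ≈⟨ R.+-cong x≈y+mz x′≈y′+mz′ ⟩
      (y ⊕ m ⊗ z) ⊕ (y′ ⊕ m ⊗ z′)       ≈⟨ interchange _ _ _ _ ⟩
      (y ⊕ y′) ⊕ (m ⊗ z ⊕ m ⊗ z′)       ≈⟨ R.+-congˡ (R.distribˡ m z z′) ⟨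
      (y ⊕ y′) ⊕ m ⊗ (z ⊕ z′)           ∎)

    *-congʳ-∼ : ∀ {x y} w → x ∼ y → x ⊗ w ∼ y ⊗ w
    *-congʳ-∼ {x} {y} w (z , x≈y+mz) = z ⊗ w , (begin
      x ⊗ w                   ≈⟨ R.*-congʳ x≈y+mz ⟩
      (y ⊕ m ⊗ z) ⊗ w         ≈⟨ R.distribʳ w y _ ⟩
      y ⊗ w ⊕ m ⊗ z ⊗ w       ≈⟨ R.+-congˡ (R.*-assoc m z w) ⟩
      y ⊗ w ⊕ m ⊗ (z ⊗ w)     ∎)

    *-cong-∼ : ∀ {x y x′ y′} → x ∼ y → x′ ∼ y′ → x ⊗ x′ ∼ y ⊗ y′
    *-cong-∼ {x} {y} {x′} {y′} x∼y x′∼y′ = ∼-trans (*-congʳ-∼ x′ x∼y)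
      (∼-trans (≈⇒∼ (R.*-comm y x′)) (∼-trans (*-congʳ-∼ y x′∼y′) (≈⇒∼ (R.*-comm y′ y))))

    -‿cong-∼ : ∀ {x y} → x ∼ y → ⊖ x ∼ ⊖ y
    -‿cong-∼ {x} {y} (z , x≈y+mz) = ⊖ z , (begin
      ⊖ x                     ≈⟨ R.-‿cong x≈y+mz ⟩
      ⊖ (y ⊕ m ⊗ z)           ≈⟨ -‿+-comm y (m ⊗ z) ⟨
      ⊖ y ⊕ ⊖ (m ⊗ z)         ≈⟨ R.+-congˡ (-‿distribʳ-* m z) ⟩
      ⊖ y ⊕ m ⊗ (⊖ z)         ∎)

    m∼0 : m ∼ 0#
    m∼0 = 1# , R.sym (R.trans (R.+-identityˡ _) (R.*-identityʳ m))

    commutativeRing : CommutativeRing c (c ⊔ ℓ)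
    commutativeRing = record
      { Carrier = Carrier ; _≈_ = _∼_ ; _+_ = _⊕_ ; _*_ = _⊗_ ; -_ = ⊖_ ; 0# = 0# ; 1# = 1#
      ; isCommutativeRing = record
        { isRing = record
          { +-isAbelianGroup = record
            { isGroup = record
              { isMonoid = record
                { isSemigroup = record
                  { isMagma = record
                    { isEquivalence = record { refl = ≈⇒∼ R.refl ; sym = ∼-sym ; trans = ∼-trans }
                    ; ∙-cong = +-cong-∼ }
                  ; assoc = λ x y z → ≈⇒∼ (R.+-assoc x y z) }
                ; identity = (λ x → ≈⇒∼ (R.+-identityˡ x)) , λ x → ≈⇒∼ (R.+-identityʳ x) }
              ; inverse = (λ x → ≈⇒∼ (R.-‿inverseˡ x)) , λ x → ≈⇒∼ (R.-‿inverseʳ x)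
              ; ⁻¹-cong = -‿cong-∼ }
            ; comm = λ x y → ≈⇒∼ (R.+-comm x y) }
          ; *-cong = *-cong-∼
          ; *-assoc = λ x y z → ≈⇒∼ (R.*-assoc x y z)
          ; *-identity = (λ x → ≈⇒∼ (R.*-identityˡ x)) , λ x → ≈⇒∼ (R.*-identityʳ x)
          ; distrib = (λ x y z → ≈⇒∼ (R.distribˡ x y z)) , λ x y z → ≈⇒∼ (R.distribʳ x y z) }
        ; *-comm = λ x y → ≈⇒∼ (R.*-comm x y) } }

  ℤ[ζ]/ : ℕ → CommutativeRing 0ℓ 0ℓ
  ℤ[ζ]/ m = Quotient.commutativeRing ℤ[ζ]-commutativeRing (const (+ m))

  module PrimeModulus {p : ℕ} (p-prime : Prime p) where
    open CommutativeRing (ℤ[ζ]/ p) using (_≈_; 0#; 1#; semiring; reflexive) renaming (trans to ≈-trans)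
    open import Algebra.Properties.Semiring.Mult semiring using () renaming (_×_ to _·_)
    open Exp semiring using () renaming (_^_ to _^/_)

    n·1≡const : ∀ n → n · 1# ≡ const (+ n)
    n·1≡const zero    = refl
    n·1≡const (suc n) = cong (λ x → 1# + x) (n·1≡const n)

    p·1≈0 : p · 1# ≈ 0#
    p·1≈0 = ≈-trans {p · 1#} {const (+ p)} {0#} (reflexive (n·1≡const p))
              (Quotient.m∼0 ℤ[ζ]-commutativeRing (const (+ p)))

    -- Applied with k = 1 to M, which is 1 modulo 10, and with k = 4 to a prime divisor of M,
    -- because the exponent of (ℤ/10)ˣ is 4.
    pᵏ≡1[10]⇒x^pᵏ≈x : ∀ k {j} → p ℕ.^ k ≡ suc (10 ℕ.* j) → ∀ x → x ^/ (p ℕ.^ k) ≈ x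
    pᵏ≡1[10]⇒x^pᵏ≈x k {j} pᵏ≡1+10j x =
      fixed-resp {x = expanded} {x} (reflexive (≡.sym (expansion x)))
        (fixed-+ {const (c₀ x)} {ζ * x₁} (fixed-const (c₀ x)) (fixed-* {ζ} {x₁} fixed-ζ
          (fixed-+ {const (c₁ x)} {ζ * x₂} (fixed-const (c₁ x)) (fixed-* {ζ} {x₂} fixed-ζ
            (fixed-+ {const (c₂ x)} {ζ * x₃} (fixed-const (c₂ x)) (fixed-* {ζ} {x₃} fixed-ζ
              (fixed-const (c₃ x))))))))
      where
      open FixedPoints.Power (ℤ[ζ]/ p) p-prime p·1≈0 k {j} pᵏ≡1+10j
      fixed-ζ : Fixed ζ
      fixed-ζ = fixed-root {ζ} (reflexive refl)
      fixed-ℕ : ∀ n → Fixed (const (+ n))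
      fixed-ℕ zero    = fixed-0
      fixed-ℕ (suc n) = fixed-+ {1#} {const (+ n)} fixed-1 (fixed-ℕ n)
      fixed-const : ∀ a → Fixed (const a)
      fixed-const (+ n)    = fixed-ℕ n
      fixed-const -[1+ n ] = fixed-- {const (+ suc n)} (fixed-ℕ (suc n))
      x₃ = const (c₃ x)
      x₂ = const (c₂ x) + ζ * x₃
      x₁ = const (c₁ x) + ζ * x₂
      expanded = const (c₀ x) + ζ * x₁

-- Group semirings of finite abelian groups

module GroupSemirings where
  open PrimeCharacteristic

  open import Data.Fin.Base using (zero; suc)

  -- An abelian group structure on Fin (suc n) with neutral element zero, presented by its subtraction.
  record IsSubtraction {n} (_⊖_ : Fin (suc n) → Fin (suc n) → Fin (suc n)) : Set where
    field
      ⊖-identityʳ  : ∀ i → i ⊖ zero ≡ i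
      ⊖-involutive : ∀ k i → k ⊖ (k ⊖ i) ≡ i
      ⊖-cancelʳ    : ∀ k i j → (k ⊖ j) ⊖ (i ⊖ j) ≡ k ⊖ i

  module GroupSemiring (S : CommutativeSemiring c ℓ) {n} {_⊖_ : Fin (suc n) → Fin (suc n) → Fin (suc n)}
                       (isSubtraction : IsSubtraction _⊖_) where
    open CommutativeSemiring S hiding (zero) renaming (refl to ≈-refl)
    open IsSubtraction isSubtraction
    open import Algebra.Properties.Semiring.Sum semiring
    open import Algebra.Properties.CommutativeSemigroup *-commutativeSemigroup using (interchange; x∙yz≈y∙xz)
    open import Relation.Binary.Reasoning.Setoid setoid

    infix  4 _≋_
    infixl 6 _⊞_
    infixl 7 _⊛_
    infixr 7 _▹_

    Element : Set c
    Element = Vector Carrier (suc n)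

    record _≋_ (f g : Element) : Set ℓ where
      constructor pointwise
      field at : ∀ k → f k ≈ g k

    open _≋_ public

    _⊞_ _⊛_ : Element → Element → Element
    (f ⊞ g) k = f k + g k
    (f ⊛ g) k = sum (λ i → f i * g (k ⊖ i))

    𝟘 𝟙 : Element
    𝟘 k       = 0#
    𝟙 zero    = 1#
    𝟙 (suc k) = 0#

    _▹_ : Carrier → Element → Element
    (c ▹ f) k = c * f k

    shift : Fin (suc n) → Element → Element
    shift t f k = f (k ⊖ t)

    -- Subtracting 0 ⊖ t amounts to adding t: the cancellation law reduces both composites to i ⊖ 0.
    ⊖-permutation : Fin (suc n) → Permutation′ (suc n)
    ⊖-permutation t = permutation (_⊖ t) (_⊖ (zero ⊖ t))
      (λ i → ≡.trans (cong ((i ⊖ (zero ⊖ t)) ⊖_) (≡.sym (⊖-involutive zero t)))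
               (≡.trans (⊖-cancelʳ i zero (zero ⊖ t)) (⊖-identityʳ i)))
      (λ i → ≡.trans (⊖-cancelʳ i zero t) (⊖-identityʳ i))

    reflection : Fin (suc n) → Permutation′ (suc n)
    reflection k = permutation (k ⊖_) (k ⊖_) (⊖-involutive k) (⊖-involutive k)

    ⊛-cong : ∀ {f f′ g g′} → f ≋ f′ → g ≋ g′ → f ⊛ g ≋ f′ ⊛ g′
    ⊛-cong f≋f′ g≋g′ = pointwise λ k → sum-cong-≋ λ i → *-cong (at f≋f′ i) (at g≋g′ (k ⊖ i))

    -- Reindexing by a translation. With it, associativity of the convolution is an interchange of
    -- two sums.
    shift-⊛ : ∀ t f g → shift t f ⊛ g ≋ shift t (f ⊛ g)
    shift-⊛ t f g = pointwise λ k → begin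
      sum (λ i → f (i ⊖ t) * g (k ⊖ i))
        ≡⟨ sum-cong-≗ (λ i → cong (λ j → f (i ⊖ t) * g j) (⊖-cancelʳ k i t)) ⟨
      sum (λ i → f (i ⊖ t) * g ((k ⊖ t) ⊖ (i ⊖ t)))
        ≈⟨ sum-permute (λ i → f i * g ((k ⊖ t) ⊖ i)) (⊖-permutation t) ⟨
      sum (λ i → f i * g ((k ⊖ t) ⊖ i)) ∎

    ⊛-assoc : ∀ f g h → (f ⊛ g) ⊛ h ≋ f ⊛ (g ⊛ h)
    ⊛-assoc f g h = pointwise λ k → begin
      sum (λ i → sum (λ j → f j * g (i ⊖ j)) * h (k ⊖ i))
        ≈⟨ sum-cong-≋ (λ i → *-distribʳ-sum (h (k ⊖ i)) (λ j → f j * g (i ⊖ j))) ⟩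
      sum (λ i → sum (λ j → f j * g (i ⊖ j) * h (k ⊖ i)))
        ≈⟨ ∑-comm (λ i j → f j * g (i ⊖ j) * h (k ⊖ i)) ⟩
      sum (λ j → sum (λ i → f j * g (i ⊖ j) * h (k ⊖ i)))
        ≈⟨ sum-cong-≋ (λ j → sum-cong-≋ (λ i → *-assoc (f j) (g (i ⊖ j)) (h (k ⊖ i)))) ⟩
      sum (λ j → sum (λ i → f j * (g (i ⊖ j) * h (k ⊖ i))))
        ≈⟨ sum-cong-≋ (λ j → *-distribˡ-sum (f j) (λ i → g (i ⊖ j) * h (k ⊖ i))) ⟨
      sum (λ j → f j * (shift j g ⊛ h) k)
        ≈⟨ sum-cong-≋ (λ j → *-congˡ {f j} (at (shift-⊛ j g h) k)) ⟩
      sum (λ j → f j * (g ⊛ h) (k ⊖ j)) ∎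

    ⊛-comm : ∀ f g → f ⊛ g ≋ g ⊛ f
    ⊛-comm f g = pointwise λ k → begin
      sum (λ i → f i * g (k ⊖ i))
        ≈⟨ sum-permute (λ i → f i * g (k ⊖ i)) (reflection k) ⟩
      sum (λ i → f (k ⊖ i) * g (k ⊖ (k ⊖ i)))
        ≡⟨ sum-cong-≗ (λ i → cong (λ j → f (k ⊖ i) * g j) (⊖-involutive k i)) ⟩
      sum (λ i → f (k ⊖ i) * g i)
        ≈⟨ sum-cong-≋ (λ i → *-comm (f (k ⊖ i)) (g i)) ⟩
      sum (λ i → g i * f (k ⊖ i)) ∎

    ⊛-identityˡ : ∀ f → 𝟙 ⊛ f ≋ f
    ⊛-identityˡ f = pointwise λ k → begin
      1# * f (k ⊖ zero) + sum (λ i → 0# * f (k ⊖ suc i))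
        ≈⟨ +-cong (trans (*-identityˡ _) (reflexive (cong f (⊖-identityʳ k))))
                  (trans (sum-cong-≋ (λ i → zeroˡ (f (k ⊖ suc i)))) (sum-replicate-zero n)) ⟩
      f k + 0#
        ≈⟨ +-identityʳ (f k) ⟩
      f k ∎

    ⊛-distribʳ : ∀ f g h → (g ⊞ h) ⊛ f ≋ g ⊛ f ⊞ h ⊛ f
    ⊛-distribʳ f g h = pointwise λ k →
      trans (sum-cong-≋ (λ i → distribʳ (f (k ⊖ i)) (g i) (h i)))
        (∑-distrib-+ (λ i → g i * f (k ⊖ i)) (λ i → h i * f (k ⊖ i)))

    ⊛-zeroˡ : ∀ f → 𝟘 ⊛ f ≋ 𝟘
    ⊛-zeroˡ f = pointwise λ k →
      trans (sum-cong-≋ (λ i → zeroˡ (f (k ⊖ i)))) (sum-replicate-zero (suc n))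

    ≋-isEquivalence : IsEquivalence _≋_
    ≋-isEquivalence = record
      { refl  = pointwise λ k → ≈-refl
      ; sym   = λ f≋g → pointwise λ k → sym (at f≋g k)
      ; trans = λ f≋g g≋h → pointwise λ k → trans (at f≋g k) (at g≋h k) }

    commutativeSemiring : CommutativeSemiring c ℓ
    commutativeSemiring = record
      { Carrier = Element ; _≈_ = _≋_ ; _+_ = _⊞_ ; _*_ = _⊛_ ; 0# = 𝟘 ; 1# = 𝟙
      ; isCommutativeSemiring = IsCommutativeSemiringˡ.isCommutativeSemiring (record
        { +-isCommutativeMonoid = IsCommutativeMonoidˡ.isCommutativeMonoid (record
          { isSemigroup = record
            { isMagma = record { isEquivalence = ≋-isEquivalence
              ; ∙-cong = λ f≋f′ g≋g′ → pointwise λ k → +-cong (at f≋f′ k) (at g≋g′ k) }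
            ; assoc = λ f g h → pointwise λ k → +-assoc (f k) (g k) (h k) }
          ; identityˡ = λ f → pointwise λ k → +-identityˡ (f k)
          ; comm = λ f g → pointwise λ k → +-comm (f k) (g k) })
        ; *-isCommutativeMonoid = IsCommutativeMonoidˡ.isCommutativeMonoid (record
          { isSemigroup = record
            { isMagma = record { isEquivalence = ≋-isEquivalence ; ∙-cong = ⊛-cong }
            ; assoc = ⊛-assoc }
          ; identityˡ = ⊛-identityˡ
          ; comm = ⊛-comm })
        ; distribʳ = ⊛-distribʳ
        ; zeroˡ = ⊛-zeroˡ }) }

    private module 𝔾 = CommutativeSemiring commutativeSemiring

    ▹-⊛ : ∀ c d f g → (c ▹ f) ⊛ (d ▹ g) ≋ (c * d) ▹ (f ⊛ g)
    ▹-⊛ c d f g = pointwise λ k →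
      trans (sum-cong-≋ (λ i → interchange c (f i) d (g (k ⊖ i))))
        (sym (*-distribˡ-sum (c * d) (λ i → f i * g (k ⊖ i))))

    open Exp semiring using (_^_)
    open Exp 𝔾.semiring using (^-congˡ) renaming (_^_ to _^ᴳ_)
    open import Algebra.Properties.Semiring.Sum 𝔾.semiring using () renaming (sum to sumᴳ; sum-cong-≋ to sumᴳ-cong-≋)
    open import Algebra.Properties.Semiring.Mult semiring renaming (_×_ to _·_) using ()
    open import Algebra.Properties.Semiring.Mult 𝔾.semiring renaming (_×_ to _·ᴳ_) using ()

    shiftⁿ : Fin (suc n) → ℕ → Element → Element
    shiftⁿ t zero    f = f
    shiftⁿ t (suc m) f = shift t (shiftⁿ t m f)

    -- That is, (c[t])ᵐ = cᵐ[mt]. The basis element [mt] appears as an iterated shift of the unit,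
    -- as the group is given by its subtraction.
    monomial-^ : ∀ c t m → (c ▹ shift t 𝟙) ^ᴳ m ≋ c ^ m ▹ shiftⁿ t m 𝟙
    monomial-^ c t zero    = pointwise λ k → sym (*-identityˡ (𝟙 k))
    monomial-^ c t (suc m) = 𝔾.trans (⊛-cong (𝔾.refl {c ▹ shift t 𝟙}) (monomial-^ c t m))
      (𝔾.trans (▹-⊛ c (c ^ m) (shift t 𝟙) (shiftⁿ t m 𝟙))
        (pointwise λ k → *-congˡ (trans (at (shift-⊛ t 𝟙 (shiftⁿ t m 𝟙)) k)
          (at (⊛-identityˡ (shiftⁿ t m 𝟙)) (k ⊖ t)))))

    sumᴳ-at : ∀ {m} (F : Vector Element m) k → sumᴳ F k ≡ sum (λ t → F t k)
    sumᴳ-at {zero}  F k = ≡.refl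
    sumᴳ-at {suc m} F k = cong (λ x → F zero k + x) (sumᴳ-at (λ t → F (suc t)) k)

    monomial-expansion : ∀ f → f ≋ sumᴳ (λ t → f t ▹ shift t 𝟙)
    monomial-expansion f = pointwise λ k → trans
      (sym (trans (at (⊛-comm f 𝟙) k) (at (⊛-identityˡ f) k)))
      (reflexive (≡.sym (sumᴳ-at (λ t → f t ▹ shift t 𝟙) k)))

    ·ᴳ-at : ∀ m f k → (m ·ᴳ f) k ≡ m · f k
    ·ᴳ-at zero    f k = ≡.refl
    ·ᴳ-at (suc m) f k = cong (λ x → f k + x) (·ᴳ-at m f k)

    ^p-at : ∀ {p} → Prime p → p · 1# ≈ 0# → ∀ f k → (f ^ᴳ p) k ≈ sum (λ t → f t ^ p * shiftⁿ t p 𝟙 k)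
    ^p-at {p} p-prime p·1≈0 f k = begin
      (f ^ᴳ p) k
        ≈⟨ at (^-congˡ p (monomial-expansion f)) k ⟩
      (sumᴳ (λ t → f t ▹ shift t 𝟙) ^ᴳ p) k
        ≈⟨ at (Frobenius.^p-homo-sum commutativeSemiring p-prime p·𝟙≋𝟘 (λ t → f t ▹ shift t 𝟙)) k ⟩
      sumᴳ (λ t → (f t ▹ shift t 𝟙) ^ᴳ p) k
        ≈⟨ at (sumᴳ-cong-≋ (λ t → monomial-^ (f t) t p)) k ⟩
      sumᴳ (λ t → f t ^ p ▹ shiftⁿ t p 𝟙) k
        ≡⟨ sumᴳ-at (λ t → f t ^ p ▹ shiftⁿ t p 𝟙) k ⟩
      sum (λ t → f t ^ p * shiftⁿ t p 𝟙 k) ∎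
      where
      p·𝟙≋𝟘 : p ·ᴳ 𝟙 ≋ 𝟘
      p·𝟙≋𝟘 = pointwise λ k → trans (reflexive (·ᴳ-at p 𝟙 k))
        (Frobenius.multiple-vanishes S {p} p·1≈0 ℕ∣.∣-refl (𝟙 k))

    private module Expᴳ = Exp 𝔾.semiring

    ^-one : ∀ g → g ^ᴳ 1 ≋ 1# ▹ g
    ^-one g = pointwise λ k → trans (at (𝔾.*-identityʳ g) k) (sym (*-identityˡ (g k)))

    -- Here f and h will be consecutive powers of χ and d a Jacobi sum. A separate c′ lets each
    -- accumulated coefficient be an explicit constant instead of a growing product.
    ^-step : ∀ {f g h c d c′} m → g ^ᴳ m ≋ c ▹ f → g ⊛ f ≋ d ▹ h → c * d ≈ c′ → g ^ᴳ suc m ≋ c′ ▹ h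
    ^-step {f} {g} {h} {c} {d} {c′} m gᵐ≋cf gf≋dh cd≈c′ = pointwise λ k → begin
      (g ⊛ g ^ᴳ m) k                         ≈⟨ at (⊛-comm g (g ^ᴳ m)) k ⟩
      (g ^ᴳ m ⊛ g) k                         ≈⟨ at (⊛-cong gᵐ≋cf (𝔾.refl {g})) k ⟩
      ((c ▹ f) ⊛ g) k                        ≈⟨ sum-cong-≋ (λ i → *-assoc c (f i) (g (k ⊖ i))) ⟩
      sum (λ i → c * (f i * g (k ⊖ i)))      ≈⟨ *-distribˡ-sum c (λ i → f i * g (k ⊖ i)) ⟨
      c * (f ⊛ g) k                          ≈⟨ *-congˡ (trans (at (⊛-comm f g) k) (at gf≋dh k)) ⟩
      c * (d * h k)                          ≈⟨ *-assoc c d (h k) ⟨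
      c * d * h k                            ≈⟨ *-congʳ cd≈c′ ⟩
      c′ * h k                               ∎

    -- Since gⁿ acts as w only on multiples of g, the induction keeps one spare factor g throughout.
    ^-periodic : ∀ {g w} n → g ^ᴳ suc n ≋ w ▹ g → ∀ e → g ^ᴳ suc (n ℕ.* e) ≋ w ^ e ▹ g
    ^-periodic {g} {w} n gⁿ⁺¹≋wg zero rewrite ℕ.*-zeroʳ n = pointwise λ k →
      trans (at (𝔾.*-identityʳ g) k) (sym (*-identityˡ (g k)))
    ^-periodic {g} {w} n gⁿ⁺¹≋wg (suc e) = pointwise λ k → begin
      (g ^ᴳ suc (n ℕ.* suc e)) k             ≡⟨ cong (λ m → (g ^ᴳ m) k) exponent ⟩
      (g ^ᴳ (n ℕ.* e ℕ.+ suc n)) k           ≈⟨ at (Expᴳ.^-homo-* g (n ℕ.* e) (suc n)) k ⟩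
      (g ^ᴳ (n ℕ.* e) ⊛ g ^ᴳ suc n) k        ≈⟨ at (⊛-cong (𝔾.refl {g ^ᴳ (n ℕ.* e)}) gⁿ⁺¹≋wg) k ⟩
      (g ^ᴳ (n ℕ.* e) ⊛ (w ▹ g)) k           ≈⟨ sum-cong-≋ (λ i → x∙yz≈y∙xz ((g ^ᴳ (n ℕ.* e)) i) w (g (k ⊖ i))) ⟩
      sum (λ i → w * ((g ^ᴳ (n ℕ.* e)) i * g (k ⊖ i))) ≈⟨ *-distribˡ-sum w (λ i → (g ^ᴳ (n ℕ.* e)) i * g (k ⊖ i)) ⟨
      w * (g ^ᴳ (n ℕ.* e) ⊛ g) k             ≈⟨ *-congˡ (at (⊛-comm (g ^ᴳ (n ℕ.* e)) g) k) ⟩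
      w * (g ^ᴳ suc (n ℕ.* e)) k             ≈⟨ *-congˡ (at (^-periodic n gⁿ⁺¹≋wg e) k) ⟩
      w * (w ^ e * g k)                      ≈⟨ *-assoc w (w ^ e) (g k) ⟨
      w ^ suc e * g k                        ∎
      where
      exponent : suc (n ℕ.* suc e) ≡ n ℕ.* e ℕ.+ suc n
      exponent = ≡.trans (cong suc (≡.trans (ℕ.*-suc n e) (ℕ.+-comm n (n ℕ.* e)))) (≡.sym (ℕ.+-suc (n ℕ.* e) n))

    -- The Frobenius map permutes the terms of g, whereas powers of g are proportional to g.
    ^p-proportional : ∀ {p} → Prime p → p · 1# ≈ 0# → ∀ {g w} n e → p ≡ suc (n ℕ.* e) →
                      g ^ᴳ suc n ≋ w ▹ g → (∀ t → g t ^ p ≈ g t) →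
                      ∀ k → w ^ e * g k ≈ sum (λ t → g t * shiftⁿ t p 𝟙 k)
    ^p-proportional {p} p-prime p·1≈0 {g} {w} n e p≡1+ne gⁿ⁺¹≋wg gᵖ≈g k = begin
      w ^ e * g k                          ≈⟨ at (^-periodic n gⁿ⁺¹≋wg e) k ⟨
      (g ^ᴳ suc (n ℕ.* e)) k               ≡⟨ cong (λ m → (g ^ᴳ m) k) p≡1+ne ⟨
      (g ^ᴳ p) k                           ≈⟨ ^p-at p-prime p·1≈0 g k ⟩
      sum (λ t → g t ^ p * shiftⁿ t p 𝟙 k) ≈⟨ sum-cong-≋ (λ t → *-congʳ {shiftⁿ t p 𝟙 k} (gᵖ≈g t)) ⟩
      sum (λ t → g t * shiftⁿ t p 𝟙 k)     ∎

-- Gauss and Jacobi sums modulo 11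

module GaussSums where
  open CyclotomicIntegers
  open GroupSemirings

  open import Data.Nat.DivMod using (_mod_)

  _⊖₁₁_ : Fin 11 → Fin 11 → Fin 11
  i ⊖₁₁ j = (toℕ i ℕ.+ (11 ℕ.∸ toℕ j)) mod 11

  ⊖₁₁-isSubtraction : IsSubtraction _⊖₁₁_
  ⊖₁₁-isSubtraction = record
    { ⊖-identityʳ  = from-yes (Fin.all? λ i → (i ⊖₁₁ 0F) Fin.≟ i)
    ; ⊖-involutive = from-yes (Fin.all? λ k → Fin.all? λ i → (k ⊖₁₁ (k ⊖₁₁ i)) Fin.≟ i)
    ; ⊖-cancelʳ    = from-yes (Fin.all? λ k → Fin.all? λ i → Fin.all? λ j → ((k ⊖₁₁ j) ⊖₁₁ (i ⊖₁₁ j)) Fin.≟ (k ⊖₁₁ i)) }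

  pointwise-≡ : ∀ {n} {A : Set} {f g : Fin n → A} → tabulate f ≡ tabulate g → ∀ i → f i ≡ g i
  pointwise-≡ {f = f} {g} eq i =
    ≡.trans (≡.sym (lookup∘tabulate f i)) (≡.trans (cong (λ v → lookup v i) eq) (lookup∘tabulate g i))

  -- Discrete logarithms modulo 11, for which 2 is a primitive root. The entry at index i belongs to
  -- i + 1.
  log₂ : Vec ℕ 10
  log₂ = 0 ∷ 1 ∷ 8 ∷ 2 ∷ 4 ∷ 9 ∷ 7 ∷ 3 ∷ 6 ∷ 5 ∷ []

  ζ-powers : Vec ℤ[ζ] 10
  ζ-powers =
    ⟪ + 1 , + 0 , + 0 , + 0 ⟫ ∷
    ⟪ + 0 , + 1 , + 0 , + 0 ⟫ ∷
    ⟪ + 0 , + 0 , + 1 , + 0 ⟫ ∷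
    ⟪ + 0 , + 0 , + 0 , + 1 ⟫ ∷
    ⟪ -[1+ 0 ] , + 1 , -[1+ 0 ] , + 1 ⟫ ∷
    ⟪ -[1+ 0 ] , + 0 , + 0 , + 0 ⟫ ∷
    ⟪ + 0 , -[1+ 0 ] , + 0 , + 0 ⟫ ∷
    ⟪ + 0 , + 0 , -[1+ 0 ] , + 0 ⟫ ∷
    ⟪ + 0 , + 0 , + 0 , -[1+ 0 ] ⟫ ∷
    ⟪ + 1 , -[1+ 0 ] , + 1 , -[1+ 0 ] ⟫ ∷ []

  -- χ is the character of 𝔽₁₁ˣ with χ(2) = ζ³; among the four characters of order 10 it is the one
  -- whose Gauss sum is divisible by the same primes above 11 as α.
  χ^ : ℕ → Fin 11 → ℤ[ζ]
  χ^ k 0F          = const 0ℤ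
  χ^ k (Fin.suc i) = lookup ζ-powers ((3 ℕ.* k ℕ.* lookup log₂ i) mod 10)

  -- g(χ) g(χ⁻¹) = χ(-1) (11 - ∑ₜ [t])
  gg̅ : Fin 11 → ℤ[ζ]
  gg̅ 0F          = const -[1+ 9 ]
  gg̅ (Fin.suc i) = const 1ℤ

  -- Jₖ = J(χ, χᵏ)
  J₁ J₂ J₃ J₄ J₅ J₆ J₇ J₈ : ℤ[ζ]
  J₁ = ⟪ -[1+ 2 ] , + 1 , + 1 , + 1 ⟫
  J₂ = ⟪ -[1+ 1 ] , + 4 , -[1+ 1 ] , + 3 ⟫
  J₃ = ⟪ -[1+ 0 ] , + 1 , -[1+ 2 ] , -[1+ 0 ] ⟫
  J₄ = ⟪ -[1+ 0 ] , -[1+ 1 ] , + 0 , + 2 ⟫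
  J₅ = ⟪ + 1 , + 2 , + 0 , -[1+ 1 ] ⟫
  J₆ = ⟪ + 1 , -[1+ 0 ] , + 3 , + 1 ⟫
  J₇ = ⟪ + 2 , -[1+ 3 ] , + 2 , -[1+ 2 ] ⟫
  J₈ = ⟪ + 3 , -[1+ 0 ] , -[1+ 0 ] , -[1+ 0 ] ⟫

  -- Pₖ = J₁ ⋯ Jₖ
  P₂ P₃ P₄ P₅ P₆ P₇ P₈ : ℤ[ζ]
  P₂ = ⟪ + 0 , -[1+ 11 ] , + 3 , -[1+ 3 ] ⟫
  P₃ = ⟪ -[1+ 7 ] , + 7 , -[1+ 13 ] , + 42 ⟫
  P₄ = ⟪ + 106 , -[1+ 144 ] , + 70 , -[1+ 99 ] ⟫
  P₅ = ⟪ + 156 , -[1+ 42 ] , -[1+ 309 ] , -[1+ 81 ] ⟫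
  P₆ = ⟪ + 1603 , -[1+ 1007 ] , + 1092 , -[1+ 635 ] ⟫
  P₇ = ⟪ + 2 , -[1+ 2583 ] , + 1670 , -[1+ 4712 ] ⟫
  P₈ = ⟪ -[1+ 8663 ] , -[1+ 6839 ] , + 1965 , -[1+ 7599 ] ⟫

  -- w = g(χ)¹⁰
  w : ℤ[ζ]
  w = ⟪ + 95304 , + 75240 , -[1+ 21614 ] , + 83600 ⟫

  module GaussSum (m : ℕ) where
    open CommutativeRing (ℤ[ζ]/ m) using (1#; commutativeSemiring; reflexive)
    open GroupSemiring commutativeSemiring ⊖₁₁-isSubtraction renaming (commutativeSemiring to groupSemiring)
    private module 𝔾 = CommutativeSemiring groupSemiring
    open Exp 𝔾.semiring using () renaming (_^_ to _^ᴳ_)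

    -- The eleven coefficients are compared in ℤ[ζ] before reduction. There they are closed terms
    -- and can be evaluated, although m is a variable.
    ≋-by-tabulation : ∀ f g → tabulate f ≡ tabulate g → f ≋ g
    ≋-by-tabulation f g eq = pointwise λ k → reflexive (pointwise-≡ {f = f} {g} eq k)

    g = χ^ 1

    g² : g ^ᴳ 2 ≋ J₁ ▹ χ^ 2
    g² = ^-step {g} {g} {χ^ 2} {1#} {J₁} {J₁} 1 (^-one g) (≋-by-tabulation (g ⊛ g) (J₁ ▹ χ^ 2) refl) (reflexive refl)

    g³ : g ^ᴳ 3 ≋ P₂ ▹ χ^ 3
    g³ = ^-step {χ^ 2} {g} {χ^ 3} {J₁} {J₂} {P₂} 2 g² (≋-by-tabulation (g ⊛ χ^ 2) (J₂ ▹ χ^ 3) refl) (reflexive refl)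

    g⁴ : g ^ᴳ 4 ≋ P₃ ▹ χ^ 4
    g⁴ = ^-step {χ^ 3} {g} {χ^ 4} {P₂} {J₃} {P₃} 3 g³ (≋-by-tabulation (g ⊛ χ^ 3) (J₃ ▹ χ^ 4) refl) (reflexive refl)

    g⁵ : g ^ᴳ 5 ≋ P₄ ▹ χ^ 5
    g⁵ = ^-step {χ^ 4} {g} {χ^ 5} {P₃} {J₄} {P₄} 4 g⁴ (≋-by-tabulation (g ⊛ χ^ 4) (J₄ ▹ χ^ 5) refl) (reflexive refl)

    g⁶ : g ^ᴳ 6 ≋ P₅ ▹ χ^ 6
    g⁶ = ^-step {χ^ 5} {g} {χ^ 6} {P₄} {J₅} {P₅} 5 g⁵ (≋-by-tabulation (g ⊛ χ^ 5) (J₅ ▹ χ^ 6) refl) (reflexive refl)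

    g⁷ : g ^ᴳ 7 ≋ P₆ ▹ χ^ 7
    g⁷ = ^-step {χ^ 6} {g} {χ^ 7} {P₅} {J₆} {P₆} 6 g⁶ (≋-by-tabulation (g ⊛ χ^ 6) (J₆ ▹ χ^ 7) refl) (reflexive refl)

    g⁸ : g ^ᴳ 8 ≋ P₇ ▹ χ^ 8
    g⁸ = ^-step {χ^ 7} {g} {χ^ 8} {P₆} {J₇} {P₇} 7 g⁷ (≋-by-tabulation (g ⊛ χ^ 7) (J₇ ▹ χ^ 8) refl) (reflexive refl)

    g⁹ : g ^ᴳ 9 ≋ P₈ ▹ χ^ 9
    g⁹ = ^-step {χ^ 8} {g} {χ^ 9} {P₇} {J₈} {P₈} 8 g⁸ (≋-by-tabulation (g ⊛ χ^ 8) (J₈ ▹ χ^ 9) refl) (reflexive refl)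

    g¹⁰ : g ^ᴳ 10 ≋ P₈ ▹ gg̅
    g¹⁰ = ^-step {χ^ 9} {g} {gg̅} {P₈} {1#} {P₈} 9 g⁹ (≋-by-tabulation (g ⊛ χ^ 9) (1# ▹ gg̅) refl) (reflexive refl)

    -- The values of χ add up to 0, so ∑ₜ [t] annihilates g, and `gg̅` acts on g as χ(-1) · 11 =
    -- -11. Hence w = -11 P₈.
    g¹¹ : g ^ᴳ 11 ≋ w ▹ g
    g¹¹ = ^-step {gg̅} {g} {g} {P₈} {const -[1+ 10 ]} {w} 10 g¹⁰ (≋-by-tabulation (g ⊛ gg̅) (const -[1+ 10 ] ▹ g) refl) (reflexive refl)

  -- The group has exponent 11. The eleven subtractions are written out because `shiftⁿ` unfolds to
  -- this form, which makes it periodic in its count.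
  ⊖₁₁-iterated-11 : ∀ k t → ((((((((((k ⊖₁₁ t) ⊖₁₁ t) ⊖₁₁ t) ⊖₁₁ t) ⊖₁₁ t) ⊖₁₁ t) ⊖₁₁ t) ⊖₁₁ t) ⊖₁₁ t) ⊖₁₁ t) ⊖₁₁ t ≡ k
  ⊖₁₁-iterated-11 = from-yes (Fin.all? λ k → Fin.all? λ t →
    (((((((((((k ⊖₁₁ t) ⊖₁₁ t) ⊖₁₁ t) ⊖₁₁ t) ⊖₁₁ t) ⊖₁₁ t) ⊖₁₁ t) ⊖₁₁ t) ⊖₁₁ t) ⊖₁₁ t) ⊖₁₁ t) Fin.≟ k)

  module Reciprocity {M : ℕ} (M-prime : Prime M) {e q : ℕ} (M≡1+10e : M ≡ suc (10 ℕ.* e)) (M≡2+11q : M ≡ 2 ℕ.+ q ℕ.* 11) where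
    open CommutativeRing (ℤ[ζ]/ M) using (_≈_; 1#; commutativeSemiring; reflexive; semiring)
      renaming (trans to ≈-trans)
    open Exp semiring using () renaming (_^_ to _^/_)
    open import Algebra.Properties.Semiring.Sum semiring using (sum; sum-cong-≗)
    open GroupSemiring commutativeSemiring ⊖₁₁-isSubtraction using (𝟙; shiftⁿ; ^p-proportional)
    open PrimeModulus M-prime
    open GaussSum M

    x^M≈x : ∀ x → x ^/ M ≈ x
    x^M≈x x = ≡.subst (λ m → x ^/ m ≈ x) (ℕ.*-identityʳ M)
      (pᵏ≡1[10]⇒x^pᵏ≈x 1 {e} (≡.trans (ℕ.*-identityʳ M) M≡1+10e) x)

    shiftⁿ-periodic : ∀ t m f n k → shiftⁿ t (m ℕ.+ n ℕ.* 11) f k ≡ shiftⁿ t m f k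
    shiftⁿ-periodic t (suc m) f n       k = shiftⁿ-periodic t m f n (k ⊖₁₁ t)
    shiftⁿ-periodic t zero    f zero    k = refl
    shiftⁿ-periodic t zero    f (suc n) k =
      ≡.trans (cong (shiftⁿ t (n ℕ.* 11) f) (⊖₁₁-iterated-11 k t)) (shiftⁿ-periodic t zero f n k)

    -- The coordinate of gᴹ at 2 is the convenient one: M ≡ 2 modulo 11, so Mt = 2 holds only for t
    -- = 1, and χ(1) = 1.
    wᵉ*χ2≈1 : w ^/ e * g 2F ≈ 1#
    wᵉ*χ2≈1 = ≈-trans {w ^/ e * g 2F} {sum (λ t → g t * shiftⁿ t M 𝟙 2F)} {1#}
      (^p-proportional M-prime p·1≈0 {g} {w} 10 e M≡1+10e g¹¹ (λ t → x^M≈x (g t)) 2F)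
      (reflexive (≡.trans (sum-cong-≗ (λ t → cong (g t *_) (shift-M t))) refl))
      where
      shift-M : ∀ t → shiftⁿ t M 𝟙 2F ≡ 𝟙 ((2F ⊖₁₁ t) ⊖₁₁ t)
      shift-M t = ≡.trans (cong (λ m → shiftⁿ t m 𝟙 2F) M≡2+11q) (shiftⁿ-periodic t 2 𝟙 q 2F)

-- The integer 11³ α and the traces of its powers

module Traces where
  open OrdersOfUnits
  open CyclotomicIntegers
  open GaussSums

  -- π = 1 - ζ₅ - ζ₅³ = 1 - ζ² + ζ
  π : ℤ[ζ]
  π = ⟪ + 1 , + 1 , -[1+ 0 ] , + 0 ⟫

  -- A = 11³ α
  A : ℤ[ζ]
  A = ⟪ + 515 , + 705 , -[1+ 248 ] , + 1005 ⟫

  module AtPrime {M : ℕ} (M-prime : Prime M) {e f q : ℕ} (M≡1+10e : M ≡ suc (10 ℕ.* e)) (e≡10f : e ≡ 10 ℕ.* f)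
                 (M≡2+11q : M ≡ 2 ℕ.+ q ℕ.* 11) (v : ℤ[ζ])
                 (11v≈1 : CommutativeRing._≈_ (ℤ[ζ]/ M) (const (+ 11) * v) (const 1ℤ)) where
    open CommutativeRing (ℤ[ζ]/ M) using (_≈_; 1#; reflexive; semiring) renaming (trans to ≈-trans)
    open Exp semiring using () renaming (_^_ to _^/_)
    open Reciprocity M-prime {e} {q} M≡1+10e M≡2+11q

    ζ³ : ℤ[ζ]
    ζ³ = ⟪ 0ℤ , 0ℤ , 0ℤ , 1ℤ ⟫

    -- H = σ₃(π) σ₋₁(π) and H̃ = π σ₋₃(π), so that H H̃ = N(π) = 11.
    H H̃ : ℤ[ζ]
    H = σ₃ π * conj π
    H̃ = π * conj (σ₃ π)

    -- Stickelberger's relation for g¹⁰, multiplied by 11³ and confirmed by evaluating the four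
    -- coefficients.
    1331w≡ : const (+ 1331) * w ≡ ζ³ * (A * H ^/ 10)
    1331w≡ = refl

    Aᵉ≈ : A ^/ e ≈ const (+ 1331) ^/ e * conj ζ³
    -- ζ³ plays two parts: the unit in `1331w≡`, which disappears in the e-th power, and the value
    -- χ(2), whose inverse remains. The inverse of `H` comes from H H̃ = 11.
    Aᵉ≈ = e-th-power (ℤ[ζ]/ M) {A} {const (+ 1331)} {H} {H̃ * v} {w} {ζ³} {conj ζ³} e f e≡10f
      (reflexive 1331w≡) (reflexive refl) (reflexive refl) wᵉ*χ2≈1
      (≡.subst (λ m → H ^/ m ≈ H) M≡1+10e (x^M≈x H))
      (≈-trans {H * (H̃ * v)} {H * H̃ * v} {1#} (reflexive (≡.sym (*-assoc H H̃ v))) 11v≈1)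

  open import Algebra.Properties.Ring ℤ.+-*-ring using () renaming (+-cancelˡ to ℤ-+-cancelˡ)

  const-homo-* : ∀ a b → const a * const b ≡ const (a ℤ.* b)
  const-homo-* a b = ≡.trans (const-* a (const b))
    (≡-by-coeffs refl (ℤ.*-zeroʳ a) (ℤ.*-zeroʳ a) (ℤ.*-zeroʳ a))

  const-homo-^ : ∀ n e → const (+ n) ^ e ≡ const (+ (n ℕ.^ e))
  const-homo-^ n zero    = refl
  const-homo-^ n (suc e) = ≡.trans (cong (const (+ n) *_) (const-homo-^ n e))
    (≡.trans (const-homo-* (+ n) (+ (n ℕ.^ e))) (cong const (≡.sym (ℤ.pos-* n (n ℕ.^ e)))))

  σ₃-const : ∀ a → σ₃ (const a) ≡ const a
  σ₃-const a = ≡-by-coeffs (ℤ.+-identityʳ a) refl refl refl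

  σ₃-^ : ∀ x e → σ₃ (x ^ e) ≡ σ₃ x ^ e
  σ₃-^ x zero    = refl
  σ₃-^ x (suc e) = ≡.trans (σ₃-* x (x ^ e)) (cong (σ₃ x *_) (σ₃-^ x e))

  -- σ₃ generates the Galois group, so its fixed elements are rational. The coefficient equations
  -- yield c₃ = 0, then c₂ = 0, then c₁ = 0.
  σ₃-fixed⇒const : ∀ x → σ₃ x ≡ x → x ≡ const (c₀ x)
  σ₃-fixed⇒const x σ₃x≡x = ≡-by-coeffs refl c₁≡0 (≡.trans (≡.sym (cong c₂ σ₃x≡x)) c₃≡0) c₃≡0
    where
    c₃≡0 : c₃ x ≡ 0ℤ
    c₃≡0 = ℤ-+-cancelˡ (c₀ x) (c₃ x) 0ℤ (≡.trans (cong c₀ σ₃x≡x) (≡.sym (ℤ.+-identityʳ (c₀ x))))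
    c₁≡0 : c₁ x ≡ 0ℤ
    c₁≡0 = ≡.trans (≡.sym (cong c₁ σ₃x≡x))
      (cong₂ (λ a b → ℤ.- (a ℤ.+ b)) (≡.trans (≡.sym (cong c₂ σ₃x≡x)) c₃≡0) c₃≡0)

  -- Y e = 1331ᵉ (αᵉ + ᾱᵉ); for e = 10ᵏ, T⁽¹⁾ e = 1331ᵉ Sₖ⁽¹⁾ and T⁽²⁾ e = 1331²ᵉ Sₖ⁽²⁾.
  Y T⁽¹⁾ T⁽²⁾ : ℕ → ℤ[ζ]
  Y e = A ^ e + conj A ^ e
  T⁽¹⁾ e = Y e + σ₃ (Y e)
  T⁽²⁾ e = Y e * σ₃ (Y e)

  -- The square of σ₃ is complex conjugation, which exchanges the two terms of `Y e`.
  σ₃σ₃Y≡Y : ∀ e → σ₃ (σ₃ (Y e)) ≡ Y e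
  σ₃σ₃Y≡Y e = begin
    σ₃ (σ₃ (A ^ e + conj A ^ e))                ≡⟨ cong σ₃ (σ₃-+ (A ^ e) (conj A ^ e)) ⟩
    σ₃ (σ₃ (A ^ e) + σ₃ (conj A ^ e))           ≡⟨ σ₃-+ (σ₃ (A ^ e)) (σ₃ (conj A ^ e)) ⟩
    σ₃ (σ₃ (A ^ e)) + σ₃ (σ₃ (conj A ^ e))      ≡⟨ cong₂ _+_ (σ₃σ₃-^ A) (σ₃σ₃-^ (conj A)) ⟩
    conj A ^ e + A ^ e                          ≡⟨ +-comm (conj A ^ e) (A ^ e) ⟩
    A ^ e + conj A ^ e                          ∎
    where
    open ≡.≡-Reasoning
    σ₃σ₃-^ : ∀ x → σ₃ (σ₃ (x ^ e)) ≡ σ₃ (σ₃ x) ^ e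
    σ₃σ₃-^ x = ≡.trans (cong σ₃ (σ₃-^ x e)) (σ₃-^ (σ₃ x) e)

  T⁽¹⁾-rational : ∀ e → T⁽¹⁾ e ≡ const (c₀ (T⁽¹⁾ e))
  T⁽¹⁾-rational e = σ₃-fixed⇒const (T⁽¹⁾ e) (≡.trans (σ₃-+ (Y e) (σ₃ (Y e)))
    (≡.trans (cong (λ t → σ₃ (Y e) + t) (σ₃σ₃Y≡Y e)) (+-comm (σ₃ (Y e)) (Y e))))

  T⁽²⁾-rational : ∀ e → T⁽²⁾ e ≡ const (c₀ (T⁽²⁾ e))
  T⁽²⁾-rational e = σ₃-fixed⇒const (T⁽²⁾ e) (≡.trans (σ₃-* (Y e) (σ₃ (Y e)))
    (≡.trans (cong (σ₃ (Y e) *_) (σ₃σ₃Y≡Y e)) (*-comm (σ₃ (Y e)) (Y e))))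

  module Mod (m : ℕ) where
    open Quotient ℤ[ζ]-commutativeRing (const (+ m)) public using (_∼_; _,_; ≈⇒∼; ∼-trans)
    open Exp (CommutativeRing.semiring (ℤ[ζ]/ m)) public using () renaming (_^_ to _^/_)

    σ₃-cong : ∀ {x y} → x ∼ y → σ₃ x ∼ σ₃ y
    σ₃-cong {x} {y} (z , x≡y+mz) = σ₃ z , ≡.trans (cong σ₃ x≡y+mz) (≡.trans (σ₃-+ y (const (+ m) * z))
      (cong (λ t → σ₃ y + t) (≡.trans (σ₃-* (const (+ m)) z) (cong (_* σ₃ z) (σ₃-const (+ m))))))

    ^/≡^ : ∀ x n → x ^/ n ≡ x ^ n
    ^/≡^ x zero    = refl
    ^/≡^ x (suc n) = cong (x *_) (^/≡^ x n)

    ∼⇒c₀ : ∀ {x y} → x ∼ y → ∃[ k ] c₀ x ≡ c₀ y ℤ.+ + m ℤ.* k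
    ∼⇒c₀ {x} {y} (z , x≡y+mz) = c₀ z , ≡.trans (cong c₀ x≡y+mz) (cong (λ t → c₀ y ℤ.+ c₀ t) (const-* (+ m) z))

    const-∼ : ∀ {a b k} → a ≡ b ℤ.+ + m ℤ.* k → const a ∼ const b
    const-∼ {a} {b} {k} a≡b+mk = const k , ≡.trans (cong const a≡b+mk)
      (cong (λ t → const b + t) (≡.sym (const-homo-* (+ m) k)))

-- Necessity modulo M and sufficiency modulo its prime divisors

module ResidueRings where
  open OrdersOfUnits
  open CyclotomicIntegers
  open Traces

  open import Data.Nat.DivMod using (_%_; _/_; m≡m%n+[m/n]*n; m%n<n)
  open import Algebra.Properties.CommutativeSemigroup
    (CommutativeRing.*-commutativeSemigroup ℤ[ζ]-commutativeRing) using (interchange)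

  -- From 5M = 10 + 55q. This makes 1 + 5q an inverse of 11 modulo M and modulo every divisor of M.
  11-inverse : ∀ {M q} → M ≡ 2 ℕ.+ q ℕ.* 11 → + 11 ℤ.* + (1 ℕ.+ 5 ℕ.* q) ≡ 1ℤ ℤ.+ + M ℤ.* + 5
  11-inverse {M} {q} refl = begin
    + 11 ℤ.* + (1 ℕ.+ 5 ℕ.* q)               ≡⟨ ℤ.pos-* 11 (1 ℕ.+ 5 ℕ.* q) ⟨
    + (11 ℕ.* (1 ℕ.+ 5 ℕ.* q))               ≡⟨ cong +_ (solve 1 (λ q → con 11 :* (con 1 :+ con 5 :* q) := con 1 :+ (con 2 :+ q :* con 11) :* con 5) refl q) ⟩
    + (1 ℕ.+ (2 ℕ.+ q ℕ.* 11) ℕ.* 5)         ≡⟨ cong (λ t → 1ℤ ℤ.+ t) (ℤ.pos-* (2 ℕ.+ q ℕ.* 11) 5) ⟩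
    1ℤ ℤ.+ + (2 ℕ.+ q ℕ.* 11) ℤ.* + 5        ∎
    where
    open ≡.≡-Reasoning
    open ℕ-Solver.+-*-Solver

  module Necessity {M : ℕ} (M-prime : Prime M) {e f q : ℕ} (M≡1+10e : M ≡ suc (10 ℕ.* e)) (e≡10f : e ≡ 10 ℕ.* f)
                   (M≡2+11q : M ≡ 2 ℕ.+ q ℕ.* 11) where
    open Mod M
    open CommutativeRing (ℤ[ζ]/ M) using (+-cong; *-cong)

    private
      D = 1331 ℕ.^ e
      C u : ℤ[ζ]
      C = const (+ D)
      ζ³ = ⟪ 0ℤ , 0ℤ , 0ℤ , 1ℤ ⟫
      u = conj ζ³ + ζ³

    11v∼1 : const (+ 11) * const (+ (1 ℕ.+ 5 ℕ.* q)) ∼ const 1ℤ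
    11v∼1 = ∼-trans {const (+ 11) * const (+ (1 ℕ.+ 5 ℕ.* q))} (≈⇒∼ (const-homo-* (+ 11) (+ (1 ℕ.+ 5 ℕ.* q))))
      (const-∼ {k = + 5} (11-inverse {q = q} M≡2+11q))

    Aᵉ∼ : A ^ e ∼ C * conj ζ³
    Aᵉ∼ = ≡.subst₂ _∼_ (^/≡^ A e)
      (cong (_* conj ζ³) (≡.trans (^/≡^ (const (+ 1331)) e) (const-homo-^ 1331 e)))
      (AtPrime.Aᵉ≈ M-prime {e} {f} {q} M≡1+10e e≡10f M≡2+11q (const (+ (1 ℕ.+ 5 ℕ.* q))) 11v∼1)

    σ₃C* : ∀ x → σ₃ (C * x) ≡ C * σ₃ x
    σ₃C* x = ≡.trans (σ₃-* C x) (cong (_* σ₃ x) (σ₃-const (+ D)))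

    Āᵉ∼ : conj A ^ e ∼ C * ζ³
    Āᵉ∼ = ≡.subst₂ _∼_ (≡.trans (cong σ₃ (σ₃-^ A e)) (σ₃-^ (σ₃ A) e))
      (≡.trans (cong σ₃ (σ₃C* (conj ζ³))) (σ₃C* (σ₃ (conj ζ³))))
      (σ₃-cong {σ₃ (A ^ e)} {σ₃ (C * conj ζ³)} (σ₃-cong {A ^ e} {C * conj ζ³} Aᵉ∼))

    Y∼ : Y e ∼ C * u
    Y∼ = ∼-trans {Y e} {C * conj ζ³ + C * ζ³} {C * u} (+-cong {A ^ e} {C * conj ζ³} {conj A ^ e} {C * ζ³} Aᵉ∼ Āᵉ∼)
      (≈⇒∼ (≡.sym (distribˡ C (conj ζ³) ζ³)))

    σ₃Y∼ : σ₃ (Y e) ∼ C * σ₃ u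
    σ₃Y∼ = ≡.subst (σ₃ (Y e) ∼_) (σ₃C* u) (σ₃-cong {Y e} {C * u} Y∼)

    T⁽¹⁾∼ : T⁽¹⁾ e ∼ C * const 1ℤ
    T⁽¹⁾∼ = ∼-trans {T⁽¹⁾ e} {C * u + C * σ₃ u} {C * const 1ℤ} (+-cong {Y e} {C * u} {σ₃ (Y e)} {C * σ₃ u} Y∼ σ₃Y∼)
      -- Here `u + σ₃ u` evaluates to 1, and below `u * σ₃ u` evaluates to -1: ζ³ + ζ⁻³ and ζ⁹ + ζ⁻⁹
      -- are the roots of X² - X - 1.
      (≈⇒∼ (≡.sym (distribˡ C u (σ₃ u))))

    T⁽²⁾∼ : T⁽²⁾ e ∼ C * C * const -1ℤ
    T⁽²⁾∼ = ∼-trans {T⁽²⁾ e} {(C * u) * (C * σ₃ u)} {C * C * const -1ℤ} (*-cong {Y e} {C * u} {σ₃ (Y e)} {C * σ₃ u} Y∼ σ₃Y∼)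
      (≈⇒∼ (interchange C u C (σ₃ u)))

    c₀T⁽¹⁾ : ∃[ k ] c₀ (T⁽¹⁾ e) ≡ + D ℤ.* 1ℤ ℤ.+ + M ℤ.* k
    c₀T⁽¹⁾ = ∼⇒c₀ (∼-trans {T⁽¹⁾ e} T⁽¹⁾∼ (≈⇒∼ (const-homo-* (+ D) 1ℤ)))

    c₀T⁽²⁾ : ∃[ k ] c₀ (T⁽²⁾ e) ≡ + (D ℕ.* D) ℤ.* -1ℤ ℤ.+ + M ℤ.* k
    c₀T⁽²⁾ = ∼⇒c₀ (∼-trans {T⁽²⁾ e} T⁽²⁾∼ (≈⇒∼ (≡.trans (cong (_* const -1ℤ)
      (≡.trans (const-homo-* (+ D) (+ D)) (cong const (≡.sym (ℤ.pos-* D D))))) (const-homo-* (+ (D ℕ.* D)) -1ℤ))))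

  -- A decidable form of "d⁴ ≡ 1 modulo 10 when d is prime to 10", so that all residues can be
  -- settled by inspection.
  FourthPowerResidue : ℕ → Set
  FourthPowerResidue d = 2 ℕ∣.∣ d ⊎ 5 ℕ∣.∣ d ⊎ d ℕ.^ 4 ≡ suc (10 ℕ.* (d ℕ.^ 4 / 10))

  fourthPowerResidue : ∀ (d : Fin 10) → FourthPowerResidue (toℕ d)
  fourthPowerResidue = from-yes (Fin.all? λ (d : Fin 10) → (2 ℕ∣.∣? toℕ d) ⊎-dec (5 ℕ∣.∣? toℕ d) ⊎-dec
    (toℕ d ℕ.^ 4 ℕ.≟ suc (10 ℕ.* (toℕ d ℕ.^ 4 / 10))))

  p⁴≡1[10] : ∀ p → ¬ (2 ℕ∣.∣ p) → ¬ (5 ℕ∣.∣ p) → ∃[ j ] p ℕ.^ 4 ≡ suc (10 ℕ.* j)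
  p⁴≡1[10] p 2∤p 5∤p =
    go (≡.subst FourthPowerResidue (Fin.toℕ-fromℕ< (m%n<n p 10)) (fourthPowerResidue (Fin.fromℕ< (m%n<n p 10))))
    where
    d = p % 10
    q = p / 10
    p≡d+10q : p ≡ d ℕ.+ q ℕ.* 10
    p≡d+10q = m≡m%n+[m/n]*n p 10
    go : FourthPowerResidue d → ∃[ j ] p ℕ.^ 4 ≡ suc (10 ℕ.* j)
    go (inj₁ 2∣d) = contradiction (≡.subst (2 ℕ∣.∣_) (≡.sym p≡d+10q)
      (ℕ∣.∣m∣n⇒∣m+n 2∣d (ℕ∣.∣n⇒∣m*n q (ℕ∣.divides 5 refl)))) 2∤p
    go (inj₂ (inj₁ 5∣d)) = contradiction (≡.subst (5 ℕ∣.∣_) (≡.sym p≡d+10q)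
      (ℕ∣.∣m∣n⇒∣m+n 5∣d (ℕ∣.∣n⇒∣m*n q (ℕ∣.divides 2 refl)))) 5∤p
    go (inj₂ (inj₂ d⁴≡)) = (d ℕ.^ 4 / 10) ℕ.+ K , (begin
      p ℕ.^ 4                                       ≡⟨ cong (ℕ._^ 4) p≡d+10q ⟩
      (d ℕ.+ q ℕ.* 10) ℕ.^ 4                        ≡⟨ solve 2 (λ d q → (d :+ q :* con 10) :^ 4 :=
          d :^ 4 :+ con 10 :* (q :* (con 4 :* d :^ 3 :+ con 60 :* d :^ 2 :* q :+ con 400 :* d :* q :^ 2 :+ con 1000 :* q :^ 3))) refl d q ⟩
      d ℕ.^ 4 ℕ.+ 10 ℕ.* K                          ≡⟨ cong (ℕ._+ 10 ℕ.* K) d⁴≡ ⟩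
      suc (10 ℕ.* (d ℕ.^ 4 / 10) ℕ.+ 10 ℕ.* K)      ≡⟨ cong suc (ℕ.*-distribˡ-+ 10 (d ℕ.^ 4 / 10) K) ⟨
      suc (10 ℕ.* ((d ℕ.^ 4 / 10) ℕ.+ K))           ∎)
      where
      open ≡.≡-Reasoning
      open ℕ-Solver.+-*-Solver
      K = q ℕ.* (4 ℕ.* d ℕ.^ 3 ℕ.+ 60 ℕ.* d ℕ.^ 2 ℕ.* q ℕ.+ 400 ℕ.* d ℕ.* q ℕ.^ 2 ℕ.+ 1000 ℕ.* q ℕ.^ 3)

  module Sufficiency {p M : ℕ} (p-prime : Prime p) (p∣M : p ℕ∣.∣ M) {s q : ℕ} (M≡1+10ʳ : M ≡ suc (10 ℕ.^ suc s))
                     (M≡2+11q : M ≡ 2 ℕ.+ q ℕ.* 11) where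
    open Mod p
    open PrimeModulus p-prime

    private
      e = 10 ℕ.^ s
      D = 1331 ℕ.^ e

    p∤10 : ¬ (p ℕ∣.∣ 10)
    p∤10 p∣10 = ¬prime[1] (≡.subst Prime (ℕ∣.∣1⇒≡1 (ℕ∣.∣m+n∣m⇒∣n
      (≡.subst (p ℕ∣.∣_) (≡.trans M≡1+10ʳ (ℕ.+-comm 1 _)) p∣M) (ℕ∣.∣m⇒∣m*n e p∣10))) p-prime)

    2∤p : ¬ (2 ℕ∣.∣ p)
    2∤p 2∣p = contradiction (ℕ∣.∣1⇒≡1 (ℕ∣.∣m+n∣m⇒∣n
      (≡.subst (2 ℕ∣.∣_) (≡.trans M≡1+10ʳ (ℕ.+-comm 1 _)) (ℕ∣.∣-trans 2∣p p∣M)) (ℕ∣.∣m⇒∣m*n e (ℕ∣.divides 5 refl)))) (λ ())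

    5∤p : ¬ (5 ℕ∣.∣ p)
    5∤p 5∣p = contradiction (ℕ∣.∣1⇒≡1 (ℕ∣.∣m+n∣m⇒∣n
      (≡.subst (5 ℕ∣.∣_) (≡.trans M≡1+10ʳ (ℕ.+-comm 1 _)) (ℕ∣.∣-trans 5∣p p∣M)) (ℕ∣.∣m⇒∣m*n e (ℕ∣.divides 2 refl)))) (λ ())

    M-multiple : ∀ {x y k} → x ≡ y ℤ.+ + M ℤ.* k → ∃[ k′ ] x ≡ y ℤ.+ + p ℤ.* k′
    M-multiple {x} {y} {k} x≡y+Mk = + j ℤ.* k , ≡.trans x≡y+Mk (cong (λ t → y ℤ.+ t)
      (≡.trans (cong (λ t → + t ℤ.* k) (≡.trans (_∣_.equality p∣M) (ℕ.*-comm j p)))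
        (≡.trans (cong (ℤ._* k) (ℤ.pos-* p j)) (ℤ.*-assoc (+ p) (+ j) k))))
      where
      open ℕ∣ using (_∣_)
      j = _∣_.quotient p∣M

    const-∼′ : ∀ {a b k} → a ≡ b ℤ.+ + M ℤ.* k → const a ∼ const b
    const-∼′ {a} {b} {k} eq = const-∼ {a} {b} (proj₂ (M-multiple {a} {b} {k} eq))

    1331-inverse : let v = + (1 ℕ.+ 5 ℕ.* q) in const (+ 1331) * const (v ℤ.* v ℤ.* v) ∼ const 1ℤ
    1331-inverse = ∼-trans {const (+ 1331) * const (v ℤ.* v ℤ.* v)} (≈⇒∼ (const-homo-* (+ 1331) (v ℤ.* v ℤ.* v)))
      -- The multiplier is read off from (1 + 5M)³ = 1 + M · 5 (3 + 15M + 25M²), the cube of the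
      -- relation for 11.
      (const-∼′ {k = + 5 ℤ.* (+ 3 ℤ.+ + 15 ℤ.* + M ℤ.+ + 25 ℤ.* (+ M ℤ.* + M))} (begin
        + 1331 ℤ.* (v ℤ.* v ℤ.* v)
          ≡⟨ solve 1 (λ v → con (+ 1331) :* (v :* v :* v) := (con (+ 11) :* v) :* (con (+ 11) :* v) :* (con (+ 11) :* v)) refl v ⟩
        (+ 11 ℤ.* v) ℤ.* (+ 11 ℤ.* v) ℤ.* (+ 11 ℤ.* v)
          ≡⟨ cong (λ t → t ℤ.* t ℤ.* t) (11-inverse {q = q} M≡2+11q) ⟩
        (1ℤ ℤ.+ + M ℤ.* + 5) ℤ.* (1ℤ ℤ.+ + M ℤ.* + 5) ℤ.* (1ℤ ℤ.+ + M ℤ.* + 5)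
          ≡⟨ solve 1 (λ M → (con 1ℤ :+ M :* con (+ 5)) :* (con 1ℤ :+ M :* con (+ 5)) :* (con 1ℤ :+ M :* con (+ 5))
               := con 1ℤ :+ M :* (con (+ 5) :* (con (+ 3) :+ con (+ 15) :* M :+ con (+ 25) :* (M :* M)))) refl (+ M) ⟩
        1ℤ ℤ.+ + M ℤ.* (+ 5 ℤ.* (+ 3 ℤ.+ + 15 ℤ.* + M ℤ.+ + 25 ℤ.* (+ M ℤ.* + M))) ∎))
      where
      v = + (1 ℕ.+ 5 ℕ.* q)
      open ≡.≡-Reasoning
      open ℤ-Solver.+-*-Solver

    const-5≁0 : ¬ (const (+ 5) ∼ const 0ℤ)
    const-5≁0 5∼0 = p∤10 (ℕ∣.∣-trans (ℕ∣.divides ℤ.∣ k ∣ (≡.trans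
      (cong ℤ.∣_∣ (≡.trans 5≡0+pk (ℤ.+-identityˡ (+ p ℤ.* k)))) (≡.trans (ℤ.abs-* (+ p) k) (ℕ.*-comm p ℤ.∣ k ∣))))
      (ℕ∣.divides 2 refl))
      where
      k = proj₁ (∼⇒c₀ {const (+ 5)} {const 0ℤ} 5∼0)
      5≡0+pk : + 5 ≡ 0ℤ ℤ.+ + p ℤ.* k
      5≡0+pk = proj₂ (∼⇒c₀ {const (+ 5)} {const 0ℤ} 5∼0)

    b^e≡D : const (+ 1331) ^/ e ≡ const (+ D)
    b^e≡D = ≡.trans (^/≡^ (const (+ 1331)) e) (const-homo-^ 1331 e)

    Y/≡Y : A ^/ e + conj A ^/ e ≡ Y e
    Y/≡Y = cong₂ _+_ (^/≡^ A e) (^/≡^ (conj A) e)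

    5ʳ∣p⁴-1 : ∀ {k k′} → c₀ (T⁽¹⁾ e) ≡ + D ℤ.* 1ℤ ℤ.+ + M ℤ.* k → c₀ (T⁽²⁾ e) ≡ + (D ℕ.* D) ℤ.* -1ℤ ℤ.+ + M ℤ.* k′ →
              ∃[ m ] p ℕ.^ 4 ≡ suc m × 5 ℕ.^ suc s ℕ∣.∣ m
    5ʳ∣p⁴-1 {k} {k′} T⁽¹⁾≡ T⁽²⁾≡ = 10 ℕ.* j , p⁴≡1+10j ,
      Order.5ʳ∣ (ℤ[ζ]/ p) {A} {conj A} {const (+ 1331)} {const (v ℤ.* v ℤ.* v)} {σ₃ (Y e)} {10 ℕ.* j} s
        x^p⁴∼x (≈⇒∼ AĀ≡) 1331-inverse sum∼ product∼ const-5≁0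
      where
      v = + (1 ℕ.+ 5 ℕ.* q)
      j = proj₁ (p⁴≡1[10] p 2∤p 5∤p)
      p⁴≡1+10j : p ℕ.^ 4 ≡ suc (10 ℕ.* j)
      p⁴≡1+10j = proj₂ (p⁴≡1[10] p 2∤p 5∤p)
      -- The product of α and its conjugate is 1, which leaves 11³ · 11³.
      AĀ≡ : A * conj A ≡ const (+ 1331) * const (+ 1331)
      AĀ≡ = refl
      x^p⁴∼x : ∀ x → x ^/ suc (10 ℕ.* j) ∼ x
      x^p⁴∼x x = ≡.subst (λ n → x ^/ n ∼ x) p⁴≡1+10j (pᵏ≡1[10]⇒x^pᵏ≈x 4 {j} p⁴≡1+10j x)
      sum-rhs : const (+ D ℤ.* 1ℤ) ≡ const (+ 1331) ^/ e
      sum-rhs = ≡.trans (cong const (ℤ.*-identityʳ (+ D))) (≡.sym b^e≡D)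
      sum∼ : (A ^/ e + conj A ^/ e) + σ₃ (Y e) ∼ const (+ 1331) ^/ e
      sum∼ = ≡.subst₂ _∼_ (cong (_+ σ₃ (Y e)) (≡.sym Y/≡Y)) sum-rhs
        (∼-trans {T⁽¹⁾ e} (≈⇒∼ (T⁽¹⁾-rational e)) (const-∼′ {k = k} T⁽¹⁾≡))
      product-rhs : const (+ (D ℕ.* D) ℤ.* -1ℤ) ≡ (const (+ 1331) ^/ e * const (+ 1331) ^/ e) * (- const 1ℤ)
      product-rhs = ≡.sym (≡.trans (cong (_* const -1ℤ) (≡.trans (cong₂ _*_ b^e≡D b^e≡D)
        (≡.trans (const-homo-* (+ D) (+ D)) (cong const (≡.sym (ℤ.pos-* D D)))))) (const-homo-* (+ (D ℕ.* D)) -1ℤ))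
      product∼ : (A ^/ e + conj A ^/ e) * σ₃ (Y e) ∼ (const (+ 1331) ^/ e * const (+ 1331) ^/ e) * (- const 1ℤ)
      product∼ = ≡.subst₂ _∼_ (cong (_* σ₃ (Y e)) (≡.sym Y/≡Y)) product-rhs
        (∼-trans {T⁽²⁾ e} (≈⇒∼ (T⁽²⁾-rational e)) (const-∼′ {k = k′} T⁽²⁾≡))

-- Comparison of ℤ[ζ] with the field ℚ(ζ)

module CyclotomicField where
  open CyclotomicIntegers
  open Traces

  open import Defs as K using (K; ⟨_,_,_,_⟩; coeff₀; coeff₁; coeff₂; coeff₃; ι; _⟦_⟧; α; α₁; α₂; S⁽¹⁾; S⁽²⁾)
    renaming (σ₃ to g₃; conj to conjᴷ; _+_ to _+ᴷ_; _*_ to _*ᴷ_; _^_ to _^ᴷ_)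

  open import Algebra.Properties.Semiring.Exp (CommutativeRing.semiring ℚ.+-*-commutativeRing) using () renaming (_^_ to _^ℚ_)

  open import Algebra.Properties.CommutativeSemigroup (CommutativeRing.*-commutativeSemigroup ℚ.+-*-commutativeRing)
    using () renaming (interchange to interchangeℚ) public

  -- Built with the constructor so that its numerator is i by computation even for variable i,
  -- whereas `i ℚ./ 1` first normalises by a gcd.
  fromℤ : ℤ → ℚ
  fromℤ i = mkℚ i 0 (Coprimality.sym (1-coprimeTo ℤ.∣ i ∣))

  /1≡fromℤ : ∀ i → i ℚ./ 1 ≡ fromℤ i
  /1≡fromℤ i = ℚ.↥p/↧p≡p (fromℤ i)

  fromℤ-homo-+ : ∀ i j → fromℤ (i ℤ.+ j) ≡ fromℤ i ℚ.+ fromℤ j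
  fromℤ-homo-+ i j = ≡.trans (≡.sym (/1≡fromℤ (i ℤ.+ j)))
    (cong (ℚ._/ 1) (≡.sym (cong₂ ℤ._+_ (ℤ.*-identityʳ i) (ℤ.*-identityʳ j))))

  fromℤ-homo-* : ∀ i j → fromℤ (i ℤ.* j) ≡ fromℤ i ℚ.* fromℤ j
  fromℤ-homo-* i j = ≡.sym (/1≡fromℤ (i ℤ.* j))

  fromℤ-homo-- : ∀ i → fromℤ (ℤ.- i) ≡ ℚ.- fromℤ i
  fromℤ-homo-- (+ zero)   = refl
  fromℤ-homo-- (+ suc n)  = refl
  fromℤ-homo-- -[1+ n ]   = refl

  infix 7 _·_

  -- A rational scalar times an integral element. All denominators gather in the scalar, and powers
  -- of α reduce to powers in ℤ[ζ].
  _·_ : ℚ → ℤ[ζ] → K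
  c · x = ⟨ c ℚ.* fromℤ (c₀ x) , c ℚ.* fromℤ (c₁ x) , c ℚ.* fromℤ (c₂ x) , c ℚ.* fromℤ (c₃ x) ⟩

  K-≡ : ∀ {x y : K} → coeff₀ x ≡ coeff₀ y → coeff₁ x ≡ coeff₁ y → coeff₂ x ≡ coeff₂ y → coeff₃ x ≡ coeff₃ y → x ≡ y
  K-≡ refl refl refl refl = refl

  private
    -- The quotient is evaluated in stages with explicit intermediate values, because the cofactor
    -- and the norm use their argument repeatedly.
    /-by-steps : ∀ {x x′ y y′ k w z} → x ≡ x′ → y ≡ y′ → K.cofactor y′ ≡ k → y′ *ᴷ k ≡ w →
                 x′ *ᴷ (k *ᴷ ι (K.ℚ-inv (coeff₀ w))) ≡ z → x K./ y ≡ z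
    /-by-steps refl refl refl refl eq = eq

    ^ᴳ-by-steps : ∀ τ {x y z} → x ≡ y → y K.^ᴳ τ ≡ z → x K.^ᴳ τ ≡ z
    ^ᴳ-by-steps τ refl eq = eq

    conj-by-steps : ∀ {x y z} → x ≡ y → conjᴷ y ≡ z → conjᴷ x ≡ z
    conj-by-steps refl eq = eq

    π′ π̄′ π̄′-cofactor eleven ρ : K
    π′ = 1ℚ · π
    π̄′ = 1ℚ · conj π
    π̄′-cofactor = 1ℚ · ⟪ + 5 , + 2 , -[1+ 0 ] , -[1+ 1 ] ⟫
    eleven = 1ℚ · const (+ 11)
    ρ = (+ 1 ℚ./ 11) · ⟪ + 4 , + 6 , -[1+ 2 ] , -[1+ 5 ] ⟫

    π/π̄≡ρ : K.π K./ conjᴷ K.π ≡ ρ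
    π/π̄≡ρ = /-by-steps {K.π} {π′} {conjᴷ K.π} {π̄′} {π̄′-cofactor} {eleven} {ρ} refl refl refl refl refl

  α≡ : α ≡ (+ 1 ℚ./ 1331) · A
  α≡ = ^ᴳ-by-steps (K.[ K.σ₁ ] K.⊕ (+ 3) K.• K.[ K.σ₋₃ ]) {K.π K./ conjᴷ K.π} {ρ} {(+ 1 ℚ./ 1331) · A} π/π̄≡ρ refl

  conj-α≡ : conjᴷ α ≡ (+ 1 ℚ./ 1331) · conj A
  conj-α≡ = conj-by-steps {α} {(+ 1 ℚ./ 1331) · A} {(+ 1 ℚ./ 1331) · conj A} α≡ refl

  private
    infixl 6 _⊕ʰ_ _⊖ʰ_
    infixl 7 _⊗ʰ_

    -- These combinators copy the syntax of an integer expression: a proof that `fromℤ` commutes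
    -- with the expression is written like the expression itself.
    _⊕ʰ_ : ∀ {i j p q} → fromℤ i ≡ p → fromℤ j ≡ q → fromℤ (i ℤ.+ j) ≡ p ℚ.+ q
    _⊕ʰ_ {i} {j} refl refl = fromℤ-homo-+ i j

    _⊗ʰ_ : ∀ i j → fromℤ (i ℤ.* j) ≡ fromℤ i ℚ.* fromℤ j
    _⊗ʰ_ = fromℤ-homo-*

    ⊖ʰ_ : ∀ {i p} → fromℤ i ≡ p → fromℤ (ℤ.- i) ≡ ℚ.- p
    ⊖ʰ_ {i} refl = fromℤ-homo-- i

    _⊖ʰ_ : ∀ {i j p q} → fromℤ i ≡ p → fromℤ j ≡ q → fromℤ (i ℤ.- j) ≡ p ℚ.- q
    eq ⊖ʰ eq′ = eq ⊕ʰ (⊖ʰ eq′)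

  module _ where
    open ℚ-Solver.+-*-Solver using (Polynomial; prove; var; con; _:+_; _:*_; :-_)
    private
      module QuadPolynomialsℚ {n : ℕ} = QuadOps {Polynomial n} _:+_ _:*_ (λ x → :- x)
      open QuadPolynomialsℚ

      env : ∀ {n} → ℤ[ζ] → Vec ℚ n → Vec ℚ (4 ℕ.+ n)
      env x ρ = fromℤ (c₀ x) ∷ fromℤ (c₁ x) ∷ fromℤ (c₂ x) ∷ fromℤ (c₃ x) ∷ ρ

      scale : ∀ {n} → Polynomial n → Quad (Polynomial n) → Quad (Polynomial n)
      scale c ⟪ a₀ , a₁ , a₂ , a₃ ⟫ = ⟪ c :* a₀ , c :* a₁ , c :* a₂ , c :* a₃ ⟫

      X X′ : Quad (Polynomial 10)
      X  = ⟪ var 2F , var 3F , var 4F , var 5F ⟫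
      X′ = ⟪ var 6F , var 7F , var 8F , var 9F ⟫

      X₁ : Quad (Polynomial 5)
      X₁ = ⟪ var 1F , var 2F , var 3F , var 4F ⟫

      ιᵖ : Polynomial 5 → Quad (Polynomial 5)
      ιᵖ a = ⟪ a , con 0ℚ , con 0ℚ , con 0ℚ ⟫

    ·-homo-* : ∀ c d x y → (c · x) *ᴷ (d · y) ≡ (c ℚ.* d) · (x * y)
    ·-homo-* c d x@(⟪ a₀ , a₁ , a₂ , a₃ ⟫) y@(⟪ b₀ , b₁ , b₂ , b₃ ⟫) = K-≡
      (≡.trans (eq c₀ refl) (cong (c ℚ.* d ℚ.*_) (≡.sym (a₀ ⊗ʰ b₀ ⊖ʰ e₄ ⊖ʰ (a₂ ⊗ʰ b₃ ⊕ʰ a₃ ⊗ʰ b₂)))))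
      (≡.trans (eq c₁ refl) (cong (c ℚ.* d ℚ.*_) (≡.sym (a₀ ⊗ʰ b₁ ⊕ʰ a₁ ⊗ʰ b₀ ⊕ʰ e₄ ⊖ʰ a₃ ⊗ʰ b₃))))
      (≡.trans (eq c₂ refl) (cong (c ℚ.* d ℚ.*_) (≡.sym (a₀ ⊗ʰ b₂ ⊕ʰ a₁ ⊗ʰ b₁ ⊕ʰ a₂ ⊗ʰ b₀ ⊖ʰ e₄))))
      (≡.trans (eq c₃ refl) (cong (c ℚ.* d ℚ.*_) (≡.sym (a₀ ⊗ʰ b₃ ⊕ʰ a₁ ⊗ʰ b₂ ⊕ʰ a₂ ⊗ʰ b₁ ⊕ʰ a₃ ⊗ʰ b₀ ⊕ʰ e₄))))
      where
      e₄ = a₁ ⊗ʰ b₃ ⊕ʰ a₂ ⊗ʰ b₂ ⊕ʰ a₃ ⊗ʰ b₁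
      eq = λ (coeff : Quad (Polynomial 10) → Polynomial 10) →
             prove (c ∷ d ∷ env x (env y [])) (coeff (scale (var 0F) X ⊠ scale (var 1F) X′))
               (var 0F :* var 1F :* coeff (X ⊠ X′))

    ·-homo-+ : ∀ c x y → (c · x) +ᴷ (c · y) ≡ c · (x + y)
    ·-homo-+ c ⟪ a₀ , a₁ , a₂ , a₃ ⟫ ⟪ b₀ , b₁ , b₂ , b₃ ⟫ = K-≡ (eq a₀ b₀) (eq a₁ b₁) (eq a₂ b₂) (eq a₃ b₃)
      where
      eq : ∀ a b → c ℚ.* fromℤ a ℚ.+ c ℚ.* fromℤ b ≡ c ℚ.* fromℤ (a ℤ.+ b)
      eq a b = ≡.trans (≡.sym (ℚ.*-distribˡ-+ c (fromℤ a) (fromℤ b))) (cong (c ℚ.*_) (≡.sym (fromℤ-homo-+ a b)))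

    σ₃-· : ∀ c x → g₃ ⟦ c · x ⟧ ≡ c · σ₃ x
    σ₃-· c x@(⟪ a₀ , a₁ , a₂ , a₃ ⟫) = K-≡
      (≡.trans (eq c₀ refl) (cong (c ℚ.*_) (≡.sym (fromℤ-homo-+ a₀ a₃))))
      (≡.trans (eq c₁ refl) (cong (c ℚ.*_) (≡.sym (⊖ʰ (fromℤ-homo-+ a₂ a₃)))))
      (eq c₂ refl)
      (≡.trans (eq c₃ refl) (cong (c ℚ.*_) (≡.sym (refl {x = fromℤ a₁} ⊖ʰ refl {x = fromℤ a₃}))))
      where
      cX : Quad (Polynomial 5)
      cX = scale (var 0F) X₁
      -- The reduced images of ζ, ζ², ζ³ under σ₃, as they arise from the definition of the Galois
      -- action on `K`.
      z³ z⁶ z⁹ : Quad (Polynomial 5)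
      z³ = ⟪ con 0ℚ , con 0ℚ , con 0ℚ , con 1ℚ ⟫
      z⁶ = ⟪ con 0ℚ , con (ℚ.- 1ℚ) , con 0ℚ , con 0ℚ ⟫
      z⁹ = ⟪ con 1ℚ , con (ℚ.- 1ℚ) , con 1ℚ , con (ℚ.- 1ℚ) ⟫
      eq = λ (coeff : Quad (Polynomial 5) → Polynomial 5) →
             prove (c ∷ env x [])
               (coeff (ιᵖ (c₀ cX) ⊞ ιᵖ (c₁ cX) ⊠ z³ ⊞ ιᵖ (c₂ cX) ⊠ z⁶ ⊞ ιᵖ (c₃ cX) ⊠ z⁹))
               (var 0F :* coeff (σ₃ᵠ X₁))

  ·-homo-^ : ∀ c x n → (c · x) ^ᴷ n ≡ (c ^ℚ n) · (x ^ n)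
  ·-homo-^ c x zero    = refl
  ·-homo-^ c x (suc n) = ≡.trans (cong ((c · x) *ᴷ_) (·-homo-^ c x n)) (·-homo-* c (c ^ℚ n) x (x ^ n))

  uᵉ : ℕ → ℚ
  uᵉ k = (+ 1 ℚ./ 1331) ^ℚ (10 ℕ.^ k)

  u^n*1331^n≡1 : ∀ n → (+ 1 ℚ./ 1331) ^ℚ n ℚ.* fromℤ (+ (1331 ℕ.^ n)) ≡ 1ℚ
  u^n*1331^n≡1 zero    = refl
  u^n*1331^n≡1 (suc n) = begin
    u ℚ.* u ^ℚ n ℚ.* fromℤ (+ (1331 ℕ.* 1331 ℕ.^ n))
      ≡⟨ cong (u ℚ.* u ^ℚ n ℚ.*_) (≡.trans (cong fromℤ (ℤ.pos-* 1331 (1331 ℕ.^ n))) (fromℤ-homo-* (+ 1331) (+ (1331 ℕ.^ n)))) ⟩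
    u ℚ.* u ^ℚ n ℚ.* (fromℤ (+ 1331) ℚ.* fromℤ (+ (1331 ℕ.^ n)))
      ≡⟨ interchangeℚ u (u ^ℚ n) (fromℤ (+ 1331)) (fromℤ (+ (1331 ℕ.^ n))) ⟩
    u ℚ.* fromℤ (+ 1331) ℚ.* (u ^ℚ n ℚ.* fromℤ (+ (1331 ℕ.^ n)))
      ≡⟨ cong (u ℚ.* fromℤ (+ 1331) ℚ.*_) (u^n*1331^n≡1 n) ⟩
    1ℚ ∎
    where
    open ≡.≡-Reasoning
    u = + 1 ℚ./ 1331

  α₁≡ : ∀ k → α₁ k ≡ uᵉ k · Y (10 ℕ.^ k)
  α₁≡ k = begin
    α ^ᴷ e +ᴷ conjᴷ α ^ᴷ e                            ≡⟨ cong₂ (λ x y → x ^ᴷ e +ᴷ y ^ᴷ e) α≡ conj-α≡ ⟩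
    (u · A) ^ᴷ e +ᴷ (u · conj A) ^ᴷ e                 ≡⟨ cong₂ _+ᴷ_ (·-homo-^ u A e) (·-homo-^ u (conj A) e) ⟩
    (uᵉ k) · (A ^ e) +ᴷ (uᵉ k) · (conj A ^ e)         ≡⟨ ·-homo-+ (uᵉ k) (A ^ e) (conj A ^ e) ⟩
    uᵉ k · Y e                                        ∎
    where
    open ≡.≡-Reasoning
    e = 10 ℕ.^ k
    u = + 1 ℚ./ 1331

  α₂≡ : ∀ k → α₂ k ≡ uᵉ k · σ₃ (Y (10 ℕ.^ k))
  α₂≡ k = ≡.trans (cong (g₃ ⟦_⟧) (α₁≡ k)) (σ₃-· (uᵉ k) (Y (10 ℕ.^ k)))

  S⁽¹⁾≡ : ∀ k → S⁽¹⁾ k ≡ uᵉ k · const (c₀ (T⁽¹⁾ (10 ℕ.^ k)))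
  S⁽¹⁾≡ k = ≡.trans (cong₂ _+ᴷ_ (α₁≡ k) (α₂≡ k)) (≡.trans (·-homo-+ (uᵉ k) (Y e) (σ₃ (Y e)))
    (cong (uᵉ k ·_) (T⁽¹⁾-rational e)))
    where e = 10 ℕ.^ k

  S⁽²⁾≡ : ∀ k → S⁽²⁾ k ≡ (uᵉ k ℚ.* uᵉ k) · const (c₀ (T⁽²⁾ (10 ℕ.^ k)))
  S⁽²⁾≡ k = ≡.trans (cong₂ _*ᴷ_ (α₁≡ k) (α₂≡ k)) (≡.trans (·-homo-* (uᵉ k) (uᵉ k) (Y e) (σ₃ (Y e)))
    (cong ((uᵉ k ℚ.* uᵉ k) ·_) (T⁽²⁾-rational e)))
    where e = 10 ℕ.^ k

-- Congruences between rationals with denominator prime to M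

module RationalCongruences where
  open CyclotomicIntegers
  open CyclotomicField

  open import Defs using (ι; Integral; _≡_⟨mod_⟩; coeff₀)
  ↥*D≡k*↧ : ∀ s D k → s ℚ.* fromℤ D ≡ fromℤ k → ↥ s ℤ.* D ≡ k ℤ.* ↧ s
  ↥*D≡k*↧ s@record{} D k sD≡k with ℚᵘ.≃-trans (ℚᵘ.≃-sym (ℚ.toℚᵘ-homo-* s (fromℤ D))) (ℚ.toℚᵘ-cong sD≡k)
  ... | ℚᵘ.*≡* eq = ≡.trans (≡.sym (ℤ.*-identityʳ _)) (≡.trans eq (cong (k ℤ.*_) (ℤ.*-identityʳ (↧ s))))

  -- Clearing denominators gives that ↧ s divides ↥ s · D, and in lowest terms ↧ s is prime to ↥ s.
  ↧∣D : ∀ s D k → s ℚ.* fromℤ (+ D) ≡ fromℤ k → ↧ₙ s ℕ∣.∣ D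
  ↧∣D s@(mkℚ n d-1 coprime) D k sD≡k = coprime-divisor (Coprimality.sym (Coprimality.recompute coprime))
    (ℕ∣.divides ℤ.∣ k ∣ (≡.trans (≡.sym (ℤ.abs-* n (+ D)))
      (≡.trans (cong ℤ.∣_∣ (↥*D≡k*↧ s (+ D) k sD≡k)) (ℤ.abs-* k (↧ s)))))

  q*↧≡↥ : ∀ q → q ℚ.* fromℤ (↧ q) ≡ fromℤ (↥ q)
  q*↧≡↥ q@record{} = ℚ.toℚᵘ-injective (ℚᵘ.≃-trans (ℚ.toℚᵘ-homo-* q (fromℤ (↧ q)))
    (ℚᵘ.*≡* (≡.trans (ℤ.*-identityʳ _) (cong (↥ q ℤ.*_) (≡.sym (ℤ.*-identityʳ (↧ q)))))))

  ∣⇒Coprime : ∀ {d D M} → d ℕ∣.∣ D → Coprime D M → Coprime d M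
  ∣⇒Coprime d∣D coprime (i∣d , i∣M) = coprime (ℕ∣.∣-trans i∣d d∣D , i∣M)

  -- Here c = 1/D is a unit of the localised ring. For the way back to the integers, a difference M
  -- q with q of denominator d prime to M gives M ∣ (a - Dε) d, and d can be cancelled.
  ≡⟨mod⟩⇔ : ∀ {c a ε D M} → c ℚ.* fromℤ (+ D) ≡ 1ℚ → Coprime D M →
            (c · const a ≡ ι (fromℤ ε) ⟨mod M ⟩) ⇔ (∃[ k ] a ≡ + D ℤ.* ε ℤ.+ + M ℤ.* k)
  ≡⟨mod⟩⇔ {c} {a} {ε} {D} {M} cD≡1 D⊥M = mk⇔ to from
    where
    open ≡.≡-Reasoning

    cancel : ∀ j → c ℚ.* fromℤ j ℚ.* fromℤ (+ D) ≡ fromℤ j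
    cancel j = begin
      c ℚ.* fromℤ j ℚ.* fromℤ (+ D)      ≡⟨ solve 3 (λ c j D → c :* j :* D := c :* D :* j) refl c (fromℤ j) (fromℤ (+ D)) ⟩
      c ℚ.* fromℤ (+ D) ℚ.* fromℤ j      ≡⟨ cong (ℚ._* fromℤ j) cD≡1 ⟩
      1ℚ ℚ.* fromℤ j                     ≡⟨ ℚ.*-identityˡ (fromℤ j) ⟩
      fromℤ j                            ∎
      where open ℚ-Solver.+-*-Solver

    integral : ∀ j → Integral M (c ℚ.* fromℤ j)
    integral j = ∣⇒Coprime (↧∣D (c ℚ.* fromℤ j) D j (cancel j)) D⊥M

    from : (∃[ k ] a ≡ + D ℤ.* ε ℤ.+ + M ℤ.* k) → c · const a ≡ ι (fromℤ ε) ⟨mod M ⟩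
    from (k , a≡Dε+Mk) = c ℚ.* fromℤ a , fromℤ ε
      , (K-≡ refl (ℚ.*-zeroʳ c) (ℚ.*-zeroʳ c) (ℚ.*-zeroʳ c) , integral a)
      , (refl , 1-coprimeTo M)
      , c ℚ.* fromℤ k , integral k , (begin
        c ℚ.* fromℤ a ℚ.- fromℤ ε
          ≡⟨ cong (λ t → c ℚ.* t ℚ.- fromℤ ε) (≡.trans (cong fromℤ a≡Dε+Mk) (≡.trans (fromℤ-homo-+ (+ D ℤ.* ε) (+ M ℤ.* k))
               (cong₂ ℚ._+_ (fromℤ-homo-* (+ D) ε) (fromℤ-homo-* (+ M) k)))) ⟩
        c ℚ.* (fromℤ (+ D) ℚ.* fromℤ ε ℚ.+ fromℤ (+ M) ℚ.* fromℤ k) ℚ.- fromℤ ε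
          ≡⟨ solve 5 (λ c D e M k → c :* (D :* e :+ M :* k) :- e := (c :* D) :* e :- e :+ M :* (c :* k)) refl
               c (fromℤ (+ D)) (fromℤ ε) (fromℤ (+ M)) (fromℤ k) ⟩
        c ℚ.* fromℤ (+ D) ℚ.* fromℤ ε ℚ.- fromℤ ε ℚ.+ fromℤ (+ M) ℚ.* (c ℚ.* fromℤ k)
          ≡⟨ cong (λ t → t ℚ.* fromℤ ε ℚ.- fromℤ ε ℚ.+ fromℤ (+ M) ℚ.* (c ℚ.* fromℤ k)) cD≡1 ⟩
        1ℚ ℚ.* fromℤ ε ℚ.- fromℤ ε ℚ.+ fromℤ (+ M) ℚ.* (c ℚ.* fromℤ k)
          ≡⟨ solve 4 (λ c e M k → con 1ℚ :* e :- e :+ M :* (c :* k) := M :* (c :* k)) refl c (fromℤ ε) (fromℤ (+ M)) (fromℤ k) ⟩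
        fromℤ (+ M) ℚ.* (c ℚ.* fromℤ k)
          ≡⟨ cong (ℚ._* (c ℚ.* fromℤ k)) (/1≡fromℤ (+ M)) ⟨
        (+ M ℚ./ 1) ℚ.* (c ℚ.* fromℤ k) ∎)
      where open ℚ-Solver.+-*-Solver

    to : c · const a ≡ ι (fromℤ ε) ⟨mod M ⟩ → ∃[ k ] a ≡ + D ℤ.* ε ℤ.+ + M ℤ.* k
    to (s , t , (ca≡s , _) , (ε≡t , _) , q , q-integral , s-t≡Mq) = k , (begin
      a                                     ≡⟨ solve 2 (λ a b → a := b :+ (a :- b)) refl a (+ D ℤ.* ε) ⟩
      + D ℤ.* ε ℤ.+ (a ℤ.- + D ℤ.* ε)       ≡⟨ cong (λ x → + D ℤ.* ε ℤ.+ x) (≡.trans (Signed._∣_.equality M∣) (ℤ.*-comm k (+ M))) ⟩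
      + D ℤ.* ε ℤ.+ + M ℤ.* k               ∎)
      where
      open ℤ-Solver.+-*-Solver
      module ℚS = ℚ-Solver.+-*-Solver
      d = ↧ q
      n = ↥ q
      difference : c ℚ.* fromℤ a ℚ.- fromℤ ε ≡ fromℤ (+ M) ℚ.* q
      difference = ≡.trans (cong₂ ℚ._-_ (cong coeff₀ ca≡s) (cong coeff₀ ε≡t))
        (≡.trans s-t≡Mq (cong (ℚ._* q) (/1≡fromℤ (+ M))))
      rational : (fromℤ a ℚ.- fromℤ (+ D) ℚ.* fromℤ ε) ℚ.* fromℤ d ≡ fromℤ (+ M) ℚ.* (fromℤ n ℚ.* fromℤ (+ D))
      rational = begin
        (fromℤ a ℚ.- fromℤ (+ D) ℚ.* fromℤ ε) ℚ.* fromℤ d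
          ≡⟨ cong (λ x → (x ℚ.- fromℤ (+ D) ℚ.* fromℤ ε) ℚ.* fromℤ d) (cancel a) ⟨
        (c ℚ.* fromℤ a ℚ.* fromℤ (+ D) ℚ.- fromℤ (+ D) ℚ.* fromℤ ε) ℚ.* fromℤ d
          ≡⟨ ℚS.solve 4 (λ x D e d → (x ℚS.:* D ℚS.:- D ℚS.:* e) ℚS.:* d ℚS.:= (x ℚS.:- e) ℚS.:* (D ℚS.:* d)) refl
               (c ℚ.* fromℤ a) (fromℤ (+ D)) (fromℤ ε) (fromℤ d) ⟩
        (c ℚ.* fromℤ a ℚ.- fromℤ ε) ℚ.* (fromℤ (+ D) ℚ.* fromℤ d)
          ≡⟨ cong (ℚ._* (fromℤ (+ D) ℚ.* fromℤ d)) difference ⟩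
        fromℤ (+ M) ℚ.* q ℚ.* (fromℤ (+ D) ℚ.* fromℤ d)
          ≡⟨ ℚS.solve 4 (λ M q D d → M ℚS.:* q ℚS.:* (D ℚS.:* d) ℚS.:= M ℚS.:* ((q ℚS.:* d) ℚS.:* D)) refl
               (fromℤ (+ M)) q (fromℤ (+ D)) (fromℤ d) ⟩
        fromℤ (+ M) ℚ.* (q ℚ.* fromℤ d ℚ.* fromℤ (+ D))
          ≡⟨ cong (λ x → fromℤ (+ M) ℚ.* (x ℚ.* fromℤ (+ D))) (q*↧≡↥ q) ⟩
        fromℤ (+ M) ℚ.* (fromℤ n ℚ.* fromℤ (+ D)) ∎
      integer : (a ℤ.- + D ℤ.* ε) ℤ.* d ≡ + M ℤ.* (n ℤ.* + D)
      integer = cong ↥_ (begin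
        fromℤ ((a ℤ.- + D ℤ.* ε) ℤ.* d)                         ≡⟨ fromℤ-homo-* (a ℤ.- + D ℤ.* ε) d ⟩
        fromℤ (a ℤ.- + D ℤ.* ε) ℚ.* fromℤ d                     ≡⟨ cong (ℚ._* fromℤ d) (≡.trans (fromℤ-homo-+ a (ℤ.- (+ D ℤ.* ε)))
          (cong (fromℤ a ℚ.+_) (≡.trans (fromℤ-homo-- (+ D ℤ.* ε)) (cong ℚ.-_ (fromℤ-homo-* (+ D) ε))))) ⟩
        (fromℤ a ℚ.- fromℤ (+ D) ℚ.* fromℤ ε) ℚ.* fromℤ d       ≡⟨ rational ⟩
        fromℤ (+ M) ℚ.* (fromℤ n ℚ.* fromℤ (+ D))               ≡⟨ cong (fromℤ (+ M) ℚ.*_) (fromℤ-homo-* n (+ D)) ⟨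
        fromℤ (+ M) ℚ.* fromℤ (n ℤ.* + D)                       ≡⟨ fromℤ-homo-* (+ M) (n ℤ.* + D) ⟨
        fromℤ (+ M ℤ.* (n ℤ.* + D))                             ∎)
      M∣ : + M Signed.∣ (a ℤ.- + D ℤ.* ε)
      M∣ = Signed.∣ᵤ⇒∣ (coprime-divisor (Coprimality.sym q-integral) (ℕ∣.divides ℤ.∣ n ℤ.* + D ∣ (begin
        ↧ₙ q ℕ.* ℤ.∣ a ℤ.- + D ℤ.* ε ∣          ≡⟨ ℕ.*-comm (↧ₙ q) _ ⟩
        ℤ.∣ a ℤ.- + D ℤ.* ε ∣ ℕ.* ↧ₙ q          ≡⟨ ℤ.abs-* (a ℤ.- + D ℤ.* ε) d ⟨
        ℤ.∣ (a ℤ.- + D ℤ.* ε) ℤ.* d ∣           ≡⟨ cong ℤ.∣_∣ integer ⟩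
        ℤ.∣ + M ℤ.* (n ℤ.* + D) ∣               ≡⟨ ℤ.abs-* (+ M) (n ℤ.* + D) ⟩
        M ℕ.* ℤ.∣ n ℤ.* + D ∣                   ≡⟨ ℕ.*-comm M _ ⟩
        ℤ.∣ n ℤ.* + D ∣ ℕ.* M                   ∎)))
      k = Signed._∣_.quotient M∣

-- The primality test

open import Defs using (1K; -_; S⁽¹⁾; S⁽²⁾; _≡_⟨mod_⟩)
open import Data.Integer.Base as ℤ using (ℤ; +_; 1ℤ)
open import Data.Integer.Divisibility using (_∣_)
open import Data.Nat.Base using (ℕ; _+_; _∸_; _^_; _≤_)
open import Data.Nat.Primality using (Prime)
open import Data.Product.Base using (_×_)
open import Function.Bundles using (_⇔_)
open import Relation.Nullary.Negation.Core using (¬_)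

open OrdersOfUnits using (^-distribʳ-*)
open CyclotomicIntegers using (c₀)
open Traces using (T⁽¹⁾; T⁽²⁾)
open ResidueRings
open CyclotomicField
open RationalCongruences

prime-divisor : ∀ d → .{{ℕ.NonTrivial d}} → ∃[ p ] Prime p × p ℕ∣.∣ d
prime-divisor d@(suc (suc _)) with factorise d
... | record { factors = [] ; isFactorisation = () }
... | record { factors = p ∷ ps ; isFactorisation = d≡ ; factorsPrime = p-prime ∷ _ } =
  p , p-prime , subst (p ℕ∣.∣_) (≡.sym d≡) (ℕ∣.m∣m*n (product ps))

rough : ∀ {m n} → (∀ {p} → Prime p → p ℕ∣.∣ n → m ≤ p) → m Rough n
rough m≤p (ℕ∣.hasNonTrivialDivisor {divisor = d} d<m d∣n) =
  ℕ.<⇒≱ d<m (ℕ.≤-trans (m≤p (proj₁ (proj₂ p)) (ℕ∣.∣-trans (proj₂ (proj₂ p)) d∣n))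
    (ℕ∣.∣⇒≤ {{ℕ.nonTrivial⇒nonZero d}} (proj₂ (proj₂ p))))
  where p = prime-divisor d

coprime-* : ∀ {m n k} → Coprime m k → Coprime n k → Coprime (m ℕ.* n) k
coprime-* m⊥k n⊥k (i∣mn , i∣k) = n⊥k (coprime-divisor (λ (j∣i , j∣m) → m⊥k (j∣m , ℕ∣.∣-trans j∣i i∣k)) i∣mn , i∣k)

coprime-^ : ∀ {m k} → Coprime m k → ∀ e → Coprime (m ^ e) k
coprime-^ m⊥k zero    = Coprimality.1-coprimeTo _
coprime-^ m⊥k (suc e) = coprime-* m⊥k (coprime-^ m⊥k e)

1331-coprime : ∀ {M q} → M ≡ 2 + q ℕ.* 11 → Coprime 1331 M
1331-coprime {M} {q} M≡2+11q = coprime-* {11} {121} 11⊥M (coprime-* {11} {11} 11⊥M 11⊥M)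
  where
  11⊥M : Coprime 11 M
  11⊥M {i} (i∣11 , i∣M) = ℕ∣.∣1⇒≡1 (ℕ∣.∣m+n∣m⇒∣n {m = 10} i∣11 (ℕ∣.∣m⇒∣m*n 5 i∣2))
    where
    i∣2 : i ℕ∣.∣ 2
    i∣2 = ℕ∣.∣m+n∣m⇒∣n (subst (i ℕ∣.∣_) (≡.trans M≡2+11q (ℕ.+-comm 2 (q ℕ.* 11))) i∣M) (ℕ∣.∣n⇒∣m*n q i∣11)

-- As r = 2h is even for n ≥ 1, 10ʳ = 100ʰ, and 100 = 1 + 9 · 11. This is the source of M ≡ 2 modulo
-- 11.
100^k≡1[11] : ∀ k → ∃[ q ] 100 ^ k ≡ 1 + q ℕ.* 11
100^k≡1[11] zero    = 0 , refl
100^k≡1[11] (suc k) with 100^k≡1[11] k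
... | q , eq = 9 + 100 ℕ.* q , ≡.trans (cong (100 ℕ.*_) eq)
  (solve 1 (λ q → con 100 :* (con 1 :+ q :* con 11) := con 1 :+ (con 9 :+ con 100 :* q) :* con 11) refl q)
  where open ℕ-Solver.+-*-Solver

10ʳ+1<25ʳ : ∀ s → 10 ^ suc s + 1 ℕ.< 5 ^ suc s ℕ.* 5 ^ suc s
10ʳ+1<25ʳ s = subst (10 ^ suc s + 1 ℕ.<_) (^-distribʳ-* 5 5 (suc s)) (go s)
  where
  open ℕ.≤-Reasoning
  go : ∀ s → 10 ^ suc s + 1 ℕ.< 25 ^ suc s
  -- The base case is 11 < 25, that is, 12 ≤ 12 + 13.
  go zero    = ℕ.m≤m+n 12 13
  go (suc s) = begin-strict
    10 ℕ.* 10 ^ suc s + 1           ≤⟨ ℕ.+-monoʳ-≤ (10 ℕ.* 10 ^ suc s) (ℕ.m≤m+n 1 9) ⟩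
    10 ℕ.* 10 ^ suc s + 10 ℕ.* 1    ≡⟨ ℕ.*-distribˡ-+ 10 (10 ^ suc s) 1 ⟨
    10 ℕ.* (10 ^ suc s + 1)         <⟨ ℕ.*-monoʳ-< 10 (go s) ⟩
    10 ℕ.* 25 ^ suc s               ≤⟨ ℕ.*-monoˡ-≤ (25 ^ suc s) (ℕ.m≤m+n 10 15) ⟩
    25 ℕ.* 25 ^ suc s               ∎

∣p⁴-1 : ∀ p {d} → ∃[ m ] p ^ 4 ≡ suc m × d ℕ∣.∣ m → + d ∣ (+ p) ℤ.^ 4 ℤ.- 1ℤ
∣p⁴-1 p {d} (m , p⁴≡1+m , d∣m) =
  subst (λ x → d ℕ∣.∣ ℤ.∣ x ℤ.- 1ℤ ∣) (≡.sym (≡.trans (pos-^ 4) (cong +_ p⁴≡1+m))) d∣m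
  where
  pos-^ : ∀ n → (+ p) ℤ.^ n ≡ + (p ^ n)
  pos-^ zero    = refl
  pos-^ (suc n) = ≡.trans (cong (+ p ℤ.*_) (pos-^ n)) (≡.sym (ℤ.pos-* p (p ^ n)))

-- s = r - 1 and e = (M - 1)/10
module PrimalityTest (s : ℕ) {q : ℕ} (M≡2+11q : 10 ^ suc s + 1 ≡ 2 + q ℕ.* 11) where
  M e : ℕ
  M = 10 ^ suc s + 1
  e = 10 ^ s

  M≡1+10ʳ : M ≡ suc (10 ^ suc s)
  M≡1+10ʳ = ℕ.+-comm (10 ^ suc s) 1

  D : ℕ
  D = 1331 ^ e

  D⊥M : Coprime D M
  D⊥M = coprime-^ (1331-coprime {q = q} M≡2+11q) e

  S⁽¹⁾≡1⇔ : (S⁽¹⁾ s ≡ 1K ⟨mod M ⟩) ⇔ (∃[ k ] c₀ (T⁽¹⁾ e) ≡ + D ℤ.* 1ℤ ℤ.+ + M ℤ.* k)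
  S⁽¹⁾≡1⇔ = subst (λ x → (x ≡ 1K ⟨mod M ⟩) ⇔ (∃[ k ] c₀ (T⁽¹⁾ e) ≡ + D ℤ.* 1ℤ ℤ.+ + M ℤ.* k)) (≡.sym (S⁽¹⁾≡ s))
    (≡⟨mod⟩⇔ {uᵉ s} {c₀ (T⁽¹⁾ e)} {1ℤ} {D} {M} (u^n*1331^n≡1 e) D⊥M)

  S⁽²⁾≡-1⇔ : (S⁽²⁾ s ≡ - 1K ⟨mod M ⟩) ⇔ (∃[ k ] c₀ (T⁽²⁾ e) ≡ + (D ℕ.* D) ℤ.* -1ℤ ℤ.+ + M ℤ.* k)
  S⁽²⁾≡-1⇔ = subst (λ x → (x ≡ - 1K ⟨mod M ⟩) ⇔ (∃[ k ] c₀ (T⁽²⁾ e) ≡ + (D ℕ.* D) ℤ.* -1ℤ ℤ.+ + M ℤ.* k)) (≡.sym (S⁽²⁾≡ s))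
    (≡⟨mod⟩⇔ {uᵉ s ℚ.* uᵉ s} {c₀ (T⁽²⁾ e)} { -1ℤ} {D ℕ.* D} {M} u²D²≡1 (coprime-* D⊥M D⊥M))
    where
    open ≡.≡-Reasoning
    u = uᵉ s
    u²D²≡1 : u ℚ.* u ℚ.* fromℤ (+ (D ℕ.* D)) ≡ 1ℚ
    u²D²≡1 = begin
      u ℚ.* u ℚ.* fromℤ (+ (D ℕ.* D))
        ≡⟨ cong (u ℚ.* u ℚ.*_) (≡.trans (cong fromℤ (ℤ.pos-* D D)) (fromℤ-homo-* (+ D) (+ D))) ⟩
      u ℚ.* u ℚ.* (fromℤ (+ D) ℚ.* fromℤ (+ D))        ≡⟨ interchangeℚ u u (fromℤ (+ D)) (fromℤ (+ D)) ⟩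
      (u ℚ.* fromℤ (+ D)) ℚ.* (u ℚ.* fromℤ (+ D))      ≡⟨ cong₂ ℚ._*_ (u^n*1331^n≡1 e) (u^n*1331^n≡1 e) ⟩
      1ℚ                                               ∎

  prime⇒congruences : ∀ {f} → e ≡ 10 ℕ.* f → Prime M → S⁽¹⁾ s ≡ 1K ⟨mod M ⟩ × S⁽²⁾ s ≡ - 1K ⟨mod M ⟩
  prime⇒congruences {f} e≡10f M-prime = Equivalence.from S⁽¹⁾≡1⇔ c₀T⁽¹⁾ , Equivalence.from S⁽²⁾≡-1⇔ c₀T⁽²⁾
    where open Necessity M-prime {e} {f} {q} M≡1+10ʳ e≡10f M≡2+11q

  congruences⇒prime :
    (∀ (x : ℤ) → 1ℤ ℤ.< x → x ℤ.< + (5 ^ suc s) → + (5 ^ suc s) ∣ x ℤ.^ 4 ℤ.- 1ℤ → ¬ (x ∣ + M)) →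
    S⁽¹⁾ s ≡ 1K ⟨mod M ⟩ × S⁽²⁾ s ≡ - 1K ⟨mod M ⟩ → Prime M
  congruences⇒prime no-small-root (S⁽¹⁾≡1 , S⁽²⁾≡-1) =
    rough∧square>⇒prime {{ℕ.n>1⇒nonTrivial M>1}} (rough p≥5ʳ) (10ʳ+1<25ʳ s)
    where
    M>1 : 1 ℕ.< M
    M>1 = ℕ.+-monoˡ-≤ 1 (ℕ.m^n>0 10 (suc s))

    p≥5ʳ : ∀ {p} → Prime p → p ℕ∣.∣ M → 5 ^ suc s ≤ p
    p≥5ʳ {p} p-prime p∣M = ℕ.≮⇒≥ λ p<5ʳ →
      -- Divisibility of integers is divisibility of absolute values, so `p∣M` fits as it stands.
      no-small-root (+ p) (ℤ.+<+ (ℕ.nonTrivial⇒n>1 p {{prime⇒nonTrivial p-prime}})) (ℤ.+<+ p<5ʳ) 5ʳ∣p⁴-1′ p∣M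
      where
      open Sufficiency p-prime p∣M {s} {q} M≡1+10ʳ M≡2+11q
      5ʳ∣p⁴-1′ : + (5 ^ suc s) ∣ (+ p) ℤ.^ 4 ℤ.- 1ℤ
      5ʳ∣p⁴-1′ = ∣p⁴-1 p (5ʳ∣p⁴-1 {proj₁ (Equivalence.to S⁽¹⁾≡1⇔ S⁽¹⁾≡1)} {proj₁ (Equivalence.to S⁽²⁾≡-1⇔ S⁽²⁾≡-1)}
        (proj₂ (Equivalence.to S⁽¹⁾≡1⇔ S⁽¹⁾≡1)) (proj₂ (Equivalence.to S⁽²⁾≡-1⇔ S⁽²⁾≡-1)))

proposition4p2 :
    ∀ (n : ℕ) → 1 ≤ n →
    let r = 2 ^ n
        M = 10 ^ (2 ^ n) + 1
    in
    (∀ (x : ℤ) → 1ℤ ℤ.< x → x ℤ.< + (5 ^ r) →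
       + (5 ^ r) ∣ x ℤ.^ 4 ℤ.- 1ℤ → ¬ (x ∣ + M)) →
    Prime M ⇔ (S⁽¹⁾ (r ∸ 1) ≡ 1K ⟨mod M ⟩ × S⁽²⁾ (r ∸ 1) ≡ - 1K ⟨mod M ⟩)
proposition4p2 (suc n) _ = go (2 ^ suc n) (2 ^ n) (ℕ.m^n>0 2 n) refl
  where
  -- `r` and its half `h` are made variables so that `r` can be matched as t + 2: then r ∸ 1
  -- computes to t + 1, and e = 10^(t+1) is visibly a multiple of 10. The equation r = 2h with h ≥ 1
  -- rules out r = 0 and r = 1.
  go : ∀ r h → 1 ≤ h → r ≡ 2 ℕ.* h →
       (∀ (x : ℤ) → 1ℤ ℤ.< x → x ℤ.< + (5 ^ r) → + (5 ^ r) ∣ x ℤ.^ 4 ℤ.- 1ℤ → ¬ (x ∣ + (10 ^ r + 1))) →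
       Prime (10 ^ r + 1) ⇔ (S⁽¹⁾ (r ∸ 1) ≡ 1K ⟨mod 10 ^ r + 1 ⟩ × S⁽²⁾ (r ∸ 1) ≡ - 1K ⟨mod 10 ^ r + 1 ⟩)
  go zero          (suc h) _ ()
  go (suc zero)    (suc h) _ r≡2h = contradiction (ℕ.suc-injective r≡2h) (λ 0≡ → ℕ.0≢1+n (≡.trans 0≡ (ℕ.+-suc h (h + 0))))
  go (suc (suc t)) h       _ r≡2h no-small-root =
    mk⇔ (prime⇒congruences {10 ^ t} refl) (congruences⇒prime no-small-root)
    where
    M≡2+11q : 10 ^ suc (suc t) + 1 ≡ 2 + proj₁ (100^k≡1[11] h) ℕ.* 11
    M≡2+11q = ≡.trans (cong (_+ 1) (≡.trans (cong (10 ^_) r≡2h) (≡.trans (≡.sym (ℕ.^-*-assoc 10 2 h)) (proj₂ (100^k≡1[11] h)))))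
      (ℕ.+-comm (1 + proj₁ (100^k≡1[11] h) ℕ.* 11) 1)
    open PrimalityTest (suc t) {proj₁ (100^k≡1[11] h)} M≡2+11q
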